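{- Let $p$ be an odd rational prime, $\zeta$ a primitive $p$-th root of unity, $K=\mathbb{Q}(\zeta)$ with ring of algebraic integers $O_{K}=\mathbb{Z}[\zeta]$, and let $\sigma,\tau$ be any two different non-zero ring endomorphisms of $O_{K}$. Then the $\mathbb{Z}$-module $\mathcal{D}_{(\sigma,\tau)}(O_{K})$ is finitely generated of rank $p-1$.
   Context: $\mathcal{D}_{(\sigma,\tau)}(O_{K})$ is the $\mathbb{Z}$-module (under pointwise operations) of all $(\sigma,\tau)$-derivations of $O_{K}$, i.e. of all $\mathbb{Z}$-linear maps $D:O_{K}\to O_{K}$ with $D(xy)=D(x)\tau(y)+\sigma(x)D(y)$ for all $x,y\in O_{K}$. -}

module Defs where

open import Algebra.Apartness.Bundles using (HeytingField; module HeytingCommutativeRing)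
open import Algebra.Bundles using (AbelianGroup; Ring; CommutativeRing)
open import Algebra.Bundles.Raw using (module RawRing)
open import Algebra.Module.Bundles using (LeftModule)
open import Algebra.Module.Morphism.Structures using (IsLeftModuleHomomorphism)
open import Algebra.Morphism.Structures using (IsRingMonomorphism; IsRingWithoutOneHomomorphism)
open import Data.Fin.Base using (toℕ)
open import Data.Integer.Base as ℤ using (ℤ; +_; -[1+_]; _⊖_)
open import Data.Integer.Properties as ℤ using ()
open import Data.Nat.Base as ℕ using (ℕ; zero; suc)
open import Data.Product.Base using (Σ; Σ-syntax; ∃-syntax; _×_; _,_; proj₁)
open import Data.Vec.Functional using (Vector)
open import Level using (_⊔_)
open import Relation.Binary.PropositionalEquality as ≡ using (_≡_)
open import Relation.Nullary.Negation using (¬_)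
import Algebra.Definitions.RawMonoid as RawMonoidDefs
import Algebra.Properties.AbelianGroup as AbelianGroupProperties
import Algebra.Properties.CommutativeMonoid.Mult as CommutativeMonoidMult
import Algebra.Properties.Ring as RingProperties
import Algebra.Properties.Semiring.Exp as SemiringExp
import Algebra.Properties.Semiring.Mult as SemiringMult
import Relation.Binary.Reasoning.Setoid as SetoidReasoning

module IntegerMultiples {a ℓ} (G : AbelianGroup a ℓ) where

  open AbelianGroup G
    renaming
    ( _∙_ to _+_; ε to 0#; _⁻¹ to -_
    ; ∙-cong to +-cong; ∙-congˡ to +-congˡ; ∙-congʳ to +-congʳ
    ; assoc to +-assoc; comm to +-comm; ⁻¹-cong to -‿cong
    ; identityˡ to +-identityˡ; identityʳ to +-identityʳ
    ; inverseˡ to -‿inverseˡ; inverseʳ to -‿inverseʳ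
    )
  open AbelianGroupProperties G
    renaming
    ( ε⁻¹≈ε to -0#≈0#; ⁻¹-involutive to -‿involutive; ⁻¹-∙-comm to -‿+-comm )
  open CommutativeMonoidMult commutativeMonoid
    renaming (_×_ to _×ⁿ_)
  open SetoidReasoning setoid

  infixr 8 _·_

  _·_ : ℤ → Carrier → Carrier
  (+ n)    · x = n ×ⁿ x
  -[1+ n ] · x = - (suc n ×ⁿ x)

  ·-cong : ∀ {i j x y} → i ≡ j → x ≈ y → i · x ≈ j · y
  ·-cong {+ n}      ≡.refl x≈y = ×-congʳ n x≈y
  ·-cong { -[1+ n ]} ≡.refl x≈y = -‿cong (×-congʳ (suc n) x≈y)

  ·-congʳ : ∀ {i j} x → i ≡ j → i · x ≈ j · x
  ·-congʳ x ≡.refl = refl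

  cancel-common : ∀ x y z → (x + y) + - (x + z) ≈ y + - z
  cancel-common x y z = begin
    (x + y) + - (x + z)      ≈⟨ +-cong (+-comm y x) (-‿+-comm x z) ⟨
    (y + x) + (- x + - z)    ≈⟨ +-assoc y x _ ⟩
    y + (x + (- x + - z))    ≈⟨ +-congˡ (+-assoc x (- x) (- z)) ⟨
    y + ((x + - x) + - z)    ≈⟨ +-congˡ (+-congʳ (-‿inverseʳ x)) ⟩
    y + (0# + - z)           ≈⟨ +-congˡ (+-identityˡ (- z)) ⟩
    y + - z                  ∎

  ⊖-· : ∀ m n x → (m ⊖ n) · x ≈ m ×ⁿ x + - (n ×ⁿ x)
  ⊖-· zero    zero    x = sym (-‿inverseʳ 0#)
  ⊖-· zero    (suc n) x = sym (+-identityˡ _)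
  ⊖-· (suc m) zero    x = sym (trans (+-congˡ -0#≈0#) (+-identityʳ _))
  ⊖-· (suc m) (suc n) x = begin
    (suc m ⊖ suc n) · x              ≈⟨ ·-congʳ x (ℤ.[1+m]⊖[1+n]≡m⊖n m n) ⟩
    (m ⊖ n) · x                      ≈⟨ ⊖-· m n x ⟩
    m ×ⁿ x + - (n ×ⁿ x)              ≈⟨ cancel-common x _ _ ⟨
    suc m ×ⁿ x + - (suc n ×ⁿ x)      ∎

  ·-distribʳ : ∀ x i j → (i ℤ.+ j) · x ≈ i · x + j · x
  ·-distribʳ x (+ m)    (+ n)    = ×-homo-+ x m n
  ·-distribʳ x (+ m)    -[1+ n ] = ⊖-· m (suc n) x
  ·-distribʳ x -[1+ m ] (+ n)    = trans (⊖-· n (suc m) x) (+-comm _ _)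
  ·-distribʳ x -[1+ m ] -[1+ n ] = begin
    - (suc (suc (m ℕ.+ n)) ×ⁿ x)     ≈⟨ -‿cong (+-congˡ (×-homo-+ x (suc m) n)) ⟩
    - (x + (suc m ×ⁿ x + n ×ⁿ x))    ≈⟨ -‿cong (+-assoc x _ _) ⟨
    - ((x + suc m ×ⁿ x) + n ×ⁿ x)    ≈⟨ -‿cong (+-congʳ (+-comm x _)) ⟩
    - ((suc m ×ⁿ x + x) + n ×ⁿ x)    ≈⟨ -‿cong (+-assoc _ x _) ⟩
    - (suc m ×ⁿ x + suc n ×ⁿ x)      ≈⟨ -‿+-comm _ _ ⟨
    - (suc m ×ⁿ x) + - (suc n ×ⁿ x)  ∎

  ·-distribˡ : ∀ i x y → i · (x + y) ≈ i · x + i · y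
  ·-distribˡ (+ n)    x y = ×-distrib-+ x y n
  ·-distribˡ -[1+ n ] x y =
    trans (-‿cong (×-distrib-+ x y (suc n))) (sym (-‿+-comm _ _))

  ·-zeroʳ : ∀ i → i · 0# ≈ 0#
  ·-zeroʳ (+ n)    = ×-zero n
    where
    ×-zero : ∀ n → n ×ⁿ 0# ≈ 0#
    ×-zero zero    = refl
    ×-zero (suc n) = trans (+-identityˡ _) (×-zero n)
  ·-zeroʳ -[1+ n ] = trans (-‿cong (·-zeroʳ (+ suc n))) -0#≈0#

  neg-· : ∀ i x → (ℤ.- i) · x ≈ - (i · x)
  neg-· (+ zero)  x = sym -0#≈0#
  neg-· (+ suc n) x = refl
  neg-· -[1+ n ]  x = sym (-‿involutive _)

  ·-neg : ∀ i x → i · (- x) ≈ - (i · x)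
  ·-neg i x = inverseˡ-unique _ _
    (trans (sym (·-distribˡ i (- x) x)) (trans (·-cong {i} ≡.refl (-‿inverseˡ x)) (·-zeroʳ i)))

  ×-·-assoc : ∀ m j x → ((+ m) ℤ.* j) · x ≈ m ×ⁿ (j · x)
  ×-·-assoc m (+ n) x = begin
    ((+ m) ℤ.* (+ n)) · x           ≈⟨ ·-congʳ x (≡.sym (ℤ.pos-* m n)) ⟩
    (m ℕ.* n) ×ⁿ x                  ≈⟨ ×-assocˡ x m n ⟨
    m ×ⁿ (n ×ⁿ x)                   ∎
  ×-·-assoc m -[1+ n ] x = begin
    ((+ m) ℤ.* -[1+ n ]) · x        ≈⟨ ·-congʳ x (≡.sym (ℤ.neg-distribʳ-* (+ m) (+ suc n))) ⟩
    (ℤ.- ((+ m) ℤ.* (+ suc n))) · x ≈⟨ neg-· ((+ m) ℤ.* (+ suc n)) x ⟩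
    - (((+ m) ℤ.* (+ suc n)) · x)   ≈⟨ -‿cong (×-·-assoc m (+ suc n) x) ⟩
    - (m ×ⁿ (suc n ×ⁿ x))           ≈⟨ ·-neg (+ m) _ ⟨
    m ×ⁿ (-[1+ n ] · x)             ∎

  ·-assoc : ∀ i j x → (i ℤ.* j) · x ≈ i · (j · x)
  ·-assoc (+ m)    j x = ×-·-assoc m j x
  ·-assoc -[1+ m ] j x = begin
    (-[1+ m ] ℤ.* j) · x            ≈⟨ ·-congʳ x (≡.sym (ℤ.neg-distribˡ-* (+ suc m) j)) ⟩
    (ℤ.- ((+ suc m) ℤ.* j)) · x     ≈⟨ neg-· ((+ suc m) ℤ.* j) x ⟩
    - (((+ suc m) ℤ.* j) · x)       ≈⟨ -‿cong (×-·-assoc (suc m) j x) ⟩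
    -[1+ m ] · (j · x)              ∎

  ·-comm : ∀ i j x → i · (j · x) ≈ j · (i · x)
  ·-comm i j x = begin
    i · (j · x)      ≈⟨ ·-assoc i j x ⟨
    (i ℤ.* j) · x    ≈⟨ ·-congʳ x (ℤ.*-comm i j) ⟩
    (j ℤ.* i) · x    ≈⟨ ·-assoc j i x ⟩
    j · (i · x)      ∎

  +-interchange : ∀ w x y z → (w + x) + (y + z) ≈ (w + y) + (x + z)
  +-interchange w x y z = begin
    (w + x) + (y + z)  ≈⟨ +-assoc w x _ ⟩
    w + (x + (y + z))  ≈⟨ +-congˡ (+-assoc x y z) ⟨
    w + ((x + y) + z)  ≈⟨ +-congˡ (+-congʳ (+-comm x y)) ⟩
    w + ((y + x) + z)  ≈⟨ +-congˡ (+-assoc y x z) ⟩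
    w + (y + (x + z))  ≈⟨ +-assoc w y _ ⟨
    (w + y) + (x + z)  ∎

  ℤ-module : LeftModule ℤ.+-*-ring a ℓ
  ℤ-module = record
    { Carrierᴹ = Carrier
    ; _≈ᴹ_ = _≈_
    ; _+ᴹ_ = _+_
    ; _*ₗ_ = _·_
    ; 0ᴹ   = 0#
    ; -ᴹ_  = -_
    ; isLeftModule = record
      { isLeftSemimodule = record
        { +ᴹ-isCommutativeMonoid = isCommutativeMonoid
        ; isPreleftSemimodule = record
          { *ₗ-cong      = ·-cong
          ; *ₗ-zeroˡ     = λ x → refl
          ; *ₗ-distribʳ  = ·-distribʳ
          ; *ₗ-identityˡ = +-identityʳ
          ; *ₗ-assoc     = ·-assoc
          ; *ₗ-zeroʳ     = ·-zeroʳ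
          ; *ₗ-distribˡ  = ·-distribˡ
          }
        }
      ; -ᴹ‿cong    = -‿cong
      ; -ᴹ‿inverse = inverse
      }
    }

open IntegerMultiples public using (ℤ-module)

module _ {r ℓr m ℓm} {R : Ring r ℓr} (M : LeftModule R m ℓm) where

  open Ring R using (0#) renaming (Carrier to Scalar; _≈_ to _≈ˢ_)
  open LeftModule M
  open RawMonoidDefs +ᴹ-rawMonoid using (sum)

  linearCombination : ∀ {n} → Vector Scalar n → Vector Carrierᴹ n → Carrierᴹ
  linearCombination c v = sum (λ i → c i *ₗ v i)

  FinitelyGenerated : Set (r ⊔ m ⊔ ℓm)
  FinitelyGenerated =
    ∃[ n ] Σ[ g ∈ Vector Carrierᴹ n ]
      (∀ x → Σ[ c ∈ Vector Scalar n ] x ≈ᴹ linearCombination c g)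

  LinearlyIndependent : ∀ {n} → Vector Carrierᴹ n → Set (r ⊔ ℓr ⊔ ℓm)
  LinearlyIndependent {n} v =
    (c : Vector Scalar n) → linearCombination c v ≈ᴹ 0ᴹ → ∀ i → c i ≈ˢ 0#

  -- The rank is the largest size of a linearly independent family.
  HasRank : ℕ → Set (r ⊔ ℓr ⊔ m ⊔ ℓm)
  HasRank k =
    (Σ[ v ∈ Vector Carrierᴹ k ] LinearlyIndependent v) ×
    (∀ n (v : Vector Carrierᴹ n) → LinearlyIndependent v → n ℕ.≤ k)

fieldRing : ∀ {c ℓ₁ ℓ₂} → HeytingField c ℓ₁ ℓ₂ → CommutativeRing c ℓ₁
fieldRing K = HeytingCommutativeRing.commutativeRing (HeytingField.heytingCommutativeRing K)

module _ {c ℓ} (R : CommutativeRing c ℓ) where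

  open CommutativeRing R
  open SemiringExp semiring using (_^_)
  open SemiringMult semiring using () renaming (_×_ to _×ⁿ_)
  open RawMonoidDefs +-rawMonoid using (sum)
  open IntegerMultiples +-abelianGroup using (_·_)

  CharacteristicZero : Set ℓ
  CharacteristicZero = ∀ n → n ×ⁿ 1# ≈ 0# → n ≡ 0

  IsPrimitiveRootOfUnity : ℕ → Carrier → Set ℓ
  IsPrimitiveRootOfUnity n ζ =
    (ζ ^ n ≈ 1#) × (∀ k → 0 ℕ.< k → k ℕ.< n → ¬ (ζ ^ k ≈ 1#))

  -- The polynomial is X ^ n + a₍ₙ₋₁₎ X ^ (n - 1) + … + a₀.
  IsAlgebraicInteger : Carrier → Set ℓ
  IsAlgebraicInteger x =
    ∃[ n ] Σ[ a ∈ Vector ℤ n ] (x ^ n + sum (λ i → a i · x ^ toℕ i) ≈ 0#)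

  -- When R is a field this is its least subfield containing ζ.  In
  -- characteristic zero that subfield contains ℚ, so it is ℚ(ζ).
  data SubfieldGeneratedBy (ζ : Carrier) : Carrier → Set (c ⊔ ℓ) where
    gen  : SubfieldGeneratedBy ζ ζ
    one  : SubfieldGeneratedBy ζ 1#
    add  : ∀ {x y} → SubfieldGeneratedBy ζ x → SubfieldGeneratedBy ζ y →
           SubfieldGeneratedBy ζ (x + y)
    neg  : ∀ {x} → SubfieldGeneratedBy ζ x → SubfieldGeneratedBy ζ (- x)
    mul  : ∀ {x y} → SubfieldGeneratedBy ζ x → SubfieldGeneratedBy ζ y →
           SubfieldGeneratedBy ζ (x * y)
    inv  : ∀ {x y} → x * y ≈ 1# → SubfieldGeneratedBy ζ x → SubfieldGeneratedBy ζ y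
    resp : ∀ {x y} → x ≈ y → SubfieldGeneratedBy ζ x → SubfieldGeneratedBy ζ y

-- K = ℚ(ζ) for a primitive p-th root of unity ζ.
record IsCyclotomicField {c ℓ₁ ℓ₂} (K : HeytingField c ℓ₁ ℓ₂) (p : ℕ)
                         (ζ : HeytingField.Carrier K) : Set (c ⊔ ℓ₁) where
  field
    characteristicZero : CharacteristicZero (fieldRing K)
    primitiveRoot      : IsPrimitiveRootOfUnity (fieldRing K) p ζ
    generated          : ∀ x → SubfieldGeneratedBy (fieldRing K) ζ x

-- O is, through the embedding ι, the subring of all algebraic integers of K.
record IsRingOfIntegers {a ℓ c ℓ₁ ℓ₂} (O : CommutativeRing a ℓ) (K : HeytingField c ℓ₁ ℓ₂)
                        (ι : CommutativeRing.Carrier O → HeytingField.Carrier K)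
                        : Set (a ⊔ ℓ ⊔ c ⊔ ℓ₁) where
  field
    isRingMonomorphism :
      IsRingMonomorphism (CommutativeRing.rawRing O) (CommutativeRing.rawRing (fieldRing K)) ι
    integral : ∀ y → IsAlgebraicInteger (fieldRing K) (ι y)
    complete : ∀ x → IsAlgebraicInteger (fieldRing K) x → ∃[ y ] HeytingField._≈_ K (ι y) x

module _ {a ℓ} (O : CommutativeRing a ℓ) where

  open CommutativeRing O
  open IntegerMultiples +-abelianGroup using (_·_; ·-cong; ·-distribˡ; ·-comm; ·-neg; +-interchange)
  open AbelianGroupProperties +-abelianGroup using () renaming (ε⁻¹≈ε to -0#≈0#; ⁻¹-∙-comm to -‿+-comm)
  open RingProperties ring using (-‿distribˡ-*; -‿distribʳ-*)
  open SemiringMult semiring using (×-comm-*; ×-assoc-*)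
  open SetoidReasoning setoid

  -- Preservation of 1# is not required: the zero map is an endomorphism, and
  -- has to be excluded separately.
  IsRingEndomorphism : (Carrier → Carrier) → Set (a ⊔ ℓ)
  IsRingEndomorphism = IsRingWithoutOneHomomorphism rawRingWithoutOne rawRingWithoutOne
    where open RawRing rawRing using (rawRingWithoutOne)

  IsNonZeroMap : (Carrier → Carrier) → Set (a ⊔ ℓ)
  IsNonZeroMap f = ¬ (∀ x → f x ≈ 0#)

  AreDifferentMaps : (Carrier → Carrier) → (Carrier → Carrier) → Set (a ⊔ ℓ)
  AreDifferentMaps f g = ¬ (∀ x → f x ≈ g x)

  private
    O-rawℤ-module = LeftModule.rawLeftModule (ℤ-module +-abelianGroup)

  record IsDerivation (σ τ : Carrier → Carrier) (D : Carrier → Carrier) : Set (a ⊔ ℓ) where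
    field
      ℤ-linear : IsLeftModuleHomomorphism O-rawℤ-module O-rawℤ-module D
      leibniz  : ∀ x y → D (x * y) ≈ D x * τ y + σ x * D y

  Derivation : (σ τ : Carrier → Carrier) → Set (a ⊔ ℓ)
  Derivation σ τ = Σ (Carrier → Carrier) (IsDerivation σ τ)

  ·-assoc-* : ∀ i x y → i · x * y ≈ i · (x * y)
  ·-assoc-* (+ n)    x y = ×-assoc-* n x y
  ·-assoc-* -[1+ n ] x y =
    trans (sym (-‿distribˡ-* _ y)) (-‿cong (×-assoc-* (suc n) x y))

  ·-comm-* : ∀ i x y → x * i · y ≈ i · (x * y)
  ·-comm-* (+ n)    x y = ×-comm-* n x y
  ·-comm-* -[1+ n ] x y =
    trans (sym (-‿distribʳ-* x _)) (-‿cong (×-comm-* (suc n) x y))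

  module _ {σ τ : Carrier → Carrier} where

    private
      mkLinear : ∀ {D} →
                 (∀ {x y} → x ≈ y → D x ≈ D y) →
                 (∀ x y → D (x + y) ≈ D x + D y) →
                 D 0# ≈ 0# →
                 (∀ x → D (- x) ≈ - D x) →
                 (∀ i x → D (i · x) ≈ i · D x) →
                 IsLeftModuleHomomorphism O-rawℤ-module O-rawℤ-module D
      mkLinear D-cong D-+ D-0 D-neg D-· = record
        { +ᴹ-isGroupHomomorphism = record
          { isMonoidHomomorphism = record
            { isMagmaHomomorphism = record
              { isRelHomomorphism = record { cong = D-cong }
              ; homo = D-+
              }
            ; ε-homo = D-0
            }
          ; ⁻¹-homo = D-neg
          }
        ; *ₗ-homo = D-·
        }

      module Lin {D} (d : IsDerivation σ τ D) where
        open IsDerivation d public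
        open IsLeftModuleHomomorphism ℤ-linear public

    zeroDerivation : Derivation σ τ
    zeroDerivation = (λ x → 0#) , record
      { ℤ-linear = mkLinear (λ _ → refl) (λ x y → sym (+-identityˡ 0#)) refl
                            (λ x → sym -0#≈0#)
                            (λ i x → sym (IntegerMultiples.·-zeroʳ +-abelianGroup i))
      ; leibniz = λ x y → sym (trans (+-cong (zeroˡ _) (zeroʳ _)) (+-identityˡ 0#))
      }

    addDerivation : Derivation σ τ → Derivation σ τ → Derivation σ τ
    addDerivation (D , d) (E , e) = (λ x → D x + E x) , record
      { ℤ-linear = mkLinear
          (λ x≈y → +-cong (D.⟦⟧-cong x≈y) (E.⟦⟧-cong x≈y))
          (λ x y → trans (+-cong (D.+ᴹ-homo x y) (E.+ᴹ-homo x y)) (+-interchange _ _ _ _))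
          (trans (+-cong D.0ᴹ-homo E.0ᴹ-homo) (+-identityˡ 0#))
          (λ x → trans (+-cong (D.-ᴹ-homo x) (E.-ᴹ-homo x)) (-‿+-comm _ _))
          (λ i x → trans (+-cong (D.*ₗ-homo i x) (E.*ₗ-homo i x)) (sym (·-distribˡ i _ _)))
      ; leibniz = λ x y → begin
          D (x * y) + E (x * y)
            ≈⟨ +-cong (D.leibniz x y) (E.leibniz x y) ⟩
          (D x * τ y + σ x * D y) + (E x * τ y + σ x * E y)
            ≈⟨ +-interchange _ _ _ _ ⟩
          (D x * τ y + E x * τ y) + (σ x * D y + σ x * E y)
            ≈⟨ +-cong (distribʳ (τ y) (D x) (E x)) (distribˡ (σ x) (D y) (E y)) ⟨
          (D x + E x) * τ y + σ x * (D y + E y)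
            ∎
      }
      where module D = Lin d
            module E = Lin e

    scaleDerivation : ℤ → Derivation σ τ → Derivation σ τ
    scaleDerivation i (D , d) = (λ x → i · D x) , record
      { ℤ-linear = mkLinear
          (λ x≈y → ·-cong {i} ≡.refl (D.⟦⟧-cong x≈y))
          (λ x y → trans (·-cong {i} ≡.refl (D.+ᴹ-homo x y)) (·-distribˡ i _ _))
          (trans (·-cong {i} ≡.refl D.0ᴹ-homo) (IntegerMultiples.·-zeroʳ +-abelianGroup i))
          (λ x → trans (·-cong {i} ≡.refl (D.-ᴹ-homo x)) (·-neg i _))
          (λ j x → trans (·-cong {i} ≡.refl (D.*ₗ-homo j x)) (·-comm i j _))
      ; leibniz = λ x y → begin
          i · D (x * y)                        ≈⟨ ·-cong {i} ≡.refl (D.leibniz x y) ⟩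
          i · (D x * τ y + σ x * D y)          ≈⟨ ·-distribˡ i _ _ ⟩
          i · (D x * τ y) + i · (σ x * D y)    ≈⟨ +-cong (·-assoc-* i _ _) (·-comm-* i _ _) ⟨
          i · D x * τ y + σ x * i · D y        ∎
      }
      where module D = Lin d

    negDerivation : Derivation σ τ → Derivation σ τ
    negDerivation (D , d) = (λ x → - D x) , record
      { ℤ-linear = mkLinear
          (λ x≈y → -‿cong (D.⟦⟧-cong x≈y))
          (λ x y → trans (-‿cong (D.+ᴹ-homo x y)) (sym (-‿+-comm _ _)))
          (trans (-‿cong D.0ᴹ-homo) -0#≈0#)
          (λ x → -‿cong (D.-ᴹ-homo x))
          (λ i x → trans (-‿cong (D.*ₗ-homo i x)) (sym (·-neg i _)))
      ; leibniz = λ x y → begin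
          - D (x * y)                          ≈⟨ -‿cong (D.leibniz x y) ⟩
          - (D x * τ y + σ x * D y)            ≈⟨ -‿+-comm _ _ ⟨
          - (D x * τ y) + - (σ x * D y)        ≈⟨ +-cong (-‿distribˡ-* _ _) (-‿distribʳ-* _ _) ⟩
          - D x * τ y + σ x * - D y            ∎
      }
      where module D = Lin d

  -- The operations and the equality are pointwise.
  𝓓 : (σ τ : Carrier → Carrier) → LeftModule ℤ.+-*-ring (a ⊔ ℓ) (a ⊔ ℓ)
  𝓓 σ τ = record
    { Carrierᴹ = Derivation σ τ
    ; _≈ᴹ_ = λ D E → ∀ x → proj₁ D x ≈ proj₁ E x
    ; _+ᴹ_ = addDerivation
    ; _*ₗ_ = scaleDerivation
    ; 0ᴹ   = zeroDerivation
    ; -ᴹ_  = negDerivation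
    ; isLeftModule = record
      { isLeftSemimodule = record
        { +ᴹ-isCommutativeMonoid = record
          { isMonoid = record
            { isSemigroup = record
              { isMagma = record
                { isEquivalence = record
                  { refl  = λ x → refl
                  ; sym   = λ p x → sym (p x)
                  ; trans = λ p q x → trans (p x) (q x)
                  }
                ; ∙-cong = λ p q x → +-cong (p x) (q x)
                }
              ; assoc = λ D E F x → +-assoc _ _ _
              }
            ; identity = (λ D x → +-identityˡ _) , (λ D x → +-identityʳ _)
            }
          ; comm = λ D E x → +-comm _ _
          }
        ; isPreleftSemimodule = record
          { *ₗ-cong      = λ i≡j p x → ℤO.*ₗ-cong i≡j (p x)
          ; *ₗ-zeroˡ     = λ D x → ℤO.*ₗ-zeroˡ (proj₁ D x)
          ; *ₗ-distribʳ  = λ D i j x → ℤO.*ₗ-distribʳ _ i j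
          ; *ₗ-identityˡ = λ D x → ℤO.*ₗ-identityˡ _
          ; *ₗ-assoc     = λ i j D x → ℤO.*ₗ-assoc i j _
          ; *ₗ-zeroʳ     = λ i x → ℤO.*ₗ-zeroʳ i
          ; *ₗ-distribˡ  = λ i D E x → ℤO.*ₗ-distribˡ i _ _
          }
        }
      ; -ᴹ‿cong    = λ p x → -‿cong (p x)
      ; -ᴹ‿inverse = (λ D x → -‿inverseˡ _) , (λ D x → -‿inverseʳ _)
      }
    }
    where module ℤO = LeftModule (ℤ-module +-abelianGroup)

{-# OPTIONS --safe #-}
-- Once O = ℤ[z] is known (ι z = ζ), a derivation D is determined by D z: comparing D (x z) with
-- D (z x) gives D x = D z · δ x, where δ x = (τ x − σ x) / (τ z − σ z) is itself a derivation
-- with values in O.  Hence 𝓓 ≅ O, and the powers of ϖ = z − 1 below ϖ ^ (p − 1) form a ℤ-basis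
-- of O.
--
-- For O = ℤ[z], every x in O has d x in ℤ[z] for some non-zero integer d, and the prime factors q
-- of d are removed one by one.  For q = p, the relation ϖ ^ (p − 1) = − p η with η ≡ 1 (mod ϖ)
-- shows that an integer combination of 1, …, ϖ ^ (p − 2) divisible by p in O has all its
-- coefficients divisible by p; by descent this also gives their linear independence.  For q ≠ p, an
-- element of ℤ[z] divisible by q in O is nilpotent in ℤ[z] / q by its integral equation, whereas
-- x ↦ x ^ q ^ (p − 1) is the identity there.

module Submission where

open import Defs
open import Algebra.Apartness.Bundles using (HeytingField)
open import Algebra.Bundles using (CommutativeRing; CommutativeSemiring)
open import Algebra.Module.Bundles using (LeftModule)
open import Algebra.Module.Morphism.Structures using (IsLeftModuleHomomorphism)
open import Algebra.Morphism.Structures using (IsRingMonomorphism; IsRingWithoutOneHomomorphism)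
open import Data.Fin.Base as Fin using (Fin; toℕ; fromℕ; inject₁; punchIn)
open import Data.Fin.Properties as Fin using (toℕ-fromℕ; toℕ-inject₁; toℕ<n)
open import Data.Integer.Base as ℤ using (ℤ; +_; -[1+_])
open import Data.Integer.Divisibility.Signed as ℤ∣ using ()
open import Data.Integer.Properties as ℤ using ()
open import Data.Integer.Solver as ℤSolver using ()
open import Data.List.Base using ([]; _∷_)
open import Data.List.Relation.Unary.All using (All; []; _∷_)
open import Data.Maybe.Base as Maybe using (Maybe)
open import Data.Nat.Base as ℕ using (ℕ; zero; suc; _∸_)
open import Data.Nat.Combinatorics using (_C_; nC1≡n; nCn≡1; k>n⇒nCk≡0; nCk+nC[k+1]≡[n+1]C[k+1])
open import Data.Nat.DivMod using (m*[n/m]≡n; n/n≡1)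
open import Data.Nat.Divisibility as ℕ∣ using (_∣_; divides)
open import Data.Nat.ListAction using (product)
open import Data.Nat.Primality using (Prime; euclidsLemma; prime⇒irreducible; ¬prime[0]; ¬prime[1])
open import Data.Nat.Primality.Factorisation using (PrimeFactorisation; factorise)
open import Data.Nat.Properties as ℕ using ()
open import Data.Nat.Solver using (module +-*-Solver)
open import Data.Product.Base using (Σ; Σ-syntax; ∃-syntax; _×_; _,_; proj₁; proj₂)
open import Data.Sum.Base using (inj₁; inj₂; [_,_]′)
open import Data.Vec.Functional as Vector using (Vector; tail; init; last)
open import Data.Vec.Functional.Properties using (insertAt-lookup; insertAt-punchIn)
open import Function.Base using (_∘_; id)
open import Level using (Level; _⊔_)
open import Relation.Binary.PropositionalEquality as ≡ using (_≡_; _≢_)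
open import Relation.Nullary.Decidable using (Dec; yes; no; ¬?; decidable-stable)
open import Relation.Nullary.Negation using (¬_; contradiction)
import Algebra.Properties.AbelianGroup as AbelianGroupProperties
import Algebra.Properties.CommutativeMonoid.Mult as CommutativeMonoidMult
import Algebra.Properties.CommutativeSemiring.Binomial as CommutativeSemiringBinomial
import Algebra.Properties.CommutativeSemiring.Exp as CommutativeSemiringExp
import Algebra.Properties.Semiring.Mult as SemiringMult
import Algebra.Properties.Semiring.Sum as SemiringSum
import Algebra.Solver.Ring as RingSolver
import Algebra.Solver.Ring.AlmostCommutativeRing as ACR
import Relation.Binary.Reasoning.Setoid as SetoidReasoning

-- Binomial coefficients and Fermat's little theorem

-- Passing from `z` to `ϖ` turns `z ^ p = 1` into an Eisenstein relation: the inner binomial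
-- coefficients of `(ϖ + 1) ^ p` are multiples of `p`, and the linear one is `p` itself, whence
-- `η ≡ 1`. Neither irreducibility of the cyclotomic polynomial nor norms nor discriminants enter.
-- Divisibility in `O` is brought down to `ℤ` or to `ℤ[z] / q` by scaling an integral equation, and
-- `monic-scaled` does this both for `q = p` and for `q ≠ p`. That some `d x` lies in `ℤ[z]` is
-- shown by induction on how `x` is generated in `K`; only inverses need an argument, again from an
-- integral equation. Equality in `K` and `O` is not assumed decidable. Case distinctions are
-- therefore made on integers only, such as the lowest coefficient of an integral equation, and
-- cancellation asks for a factor that is provably non-zero.

absorption : ∀ n k → suc k ℕ.* (suc n C suc k) ≡ suc n ℕ.* (n C k)
absorption zero    zero    = ≡.refl
absorption zero    (suc k) = ≡.trans
  (≡.cong (suc (suc k) ℕ.*_) (k>n⇒nCk≡0 {1} {suc (suc k)} (ℕ.s≤s (ℕ.s≤s ℕ.z≤n))))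
  (ℕ.*-zeroʳ (suc (suc k)))
absorption (suc n) zero    = ≡.trans (ℕ.*-identityˡ (suc (suc n) C 1))
  (≡.trans (nC1≡n (suc (suc n))) (≡.sym (ℕ.*-identityʳ _)))
absorption (suc n) (suc k) = begin
  suc (suc k) ℕ.* (suc (suc n) C suc (suc k))
    ≡⟨ ≡.cong (suc (suc k) ℕ.*_) (nCk+nC[k+1]≡[n+1]C[k+1] (suc n) (suc k)) ⟨
  suc (suc k) ℕ.* (c ℕ.+ (suc n C suc (suc k)))
    ≡⟨ solve 3 (λ k c e → (con 2 :+ k) :* (c :+ e) := (con 1 :+ k) :* c :+ c :+ (con 2 :+ k) :* e) ≡.refl k c _ ⟩
  suc k ℕ.* c ℕ.+ c ℕ.+ suc (suc k) ℕ.* (suc n C suc (suc k))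
    ≡⟨ ≡.cong₂ (λ u v → u ℕ.+ c ℕ.+ v) (absorption n k) (absorption n (suc k)) ⟩
  suc n ℕ.* (n C k) ℕ.+ c ℕ.+ suc n ℕ.* (n C suc k)
    ≡⟨ solve 4 (λ n a c b → (con 1 :+ n) :* a :+ c :+ (con 1 :+ n) :* b := (con 1 :+ n) :* (a :+ b) :+ c) ≡.refl n (n C k) c _ ⟩
  suc n ℕ.* ((n C k) ℕ.+ (n C suc k)) ℕ.+ c
    ≡⟨ ≡.cong (λ u → suc n ℕ.* u ℕ.+ c) (nCk+nC[k+1]≡[n+1]C[k+1] n k) ⟩
  suc n ℕ.* c ℕ.+ c
    ≡⟨ ℕ.+-comm _ c ⟩
  suc (suc n) ℕ.* c ∎
  where
  open ≡.≡-Reasoning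
  open +-*-Solver
  c = suc n C suc k

-- By `absorption` the prime divides `suc k` times the coefficient, and `suc k` is too small to be a
-- multiple of it.
prime∣nCk : ∀ {n k} → Prime (suc n) → k ℕ.< n → suc n ∣ (suc n C suc k)
prime∣nCk {n} {k} p-prime k<n
  with euclidsLemma (suc k) (suc n C suc k) p-prime
         (ℕ∣.∣-trans (ℕ∣.m∣m*n (n C k)) (ℕ∣.∣-reflexive (≡.sym (absorption n k))))
... | inj₁ p∣1+k = contradiction (ℕ∣.∣⇒≤ p∣1+k) (ℕ.<⇒≱ (ℕ.s≤s k<n))
... | inj₂ p∣C   = p∣C

prime∣^⇒∣ : ∀ {p} → Prime p → ∀ m n → p ∣ m ℕ.^ n → p ∣ m
prime∣^⇒∣ p-prime m zero    p∣1 = contradiction (≡.subst Prime (ℕ∣.∣1⇒≡1 p∣1) p-prime) ¬prime[1]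
prime∣^⇒∣ p-prime m (suc n) p∣m^ = [ id , prime∣^⇒∣ p-prime m n ]′ (euclidsLemma m _ p-prime p∣m^)

-- Serves two ends: a high enough power of `q` exceeds the degree of an integral equation, and
-- `p ^ k` can divide `k` only for `k = 0`.
n<2+k^n : ∀ k n → n ℕ.< suc (suc k) ℕ.^ n
n<2+k^n k zero    = ℕ.s≤s ℕ.z≤n
n<2+k^n k (suc n) = begin
  suc (suc n)                          ≤⟨ ℕ.+-mono-≤ (ℕ.m^n>0 (suc (suc k)) n) (n<2+k^n k n) ⟩
  b ℕ.+ b                              ≤⟨ ℕ.+-monoʳ-≤ b (ℕ.m≤m+n b (k ℕ.* b)) ⟩
  suc (suc k) ℕ.* b                    ∎
  where
  open ℕ.≤-Reasoning
  b = suc (suc k) ℕ.^ n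

module PrimeBinomial (m : ℕ) (p-prime : Prime (suc (suc m))) where

  private
    p = suc (suc m)

  -- Index `i` belongs to `x ^ (i + 1)`, so the vector runs over exactly the `p - 1` inner
  -- coefficients; the division is exact by `prime∣nCk`.
  binomialQuotient : Vector ℕ (suc m)
  binomialQuotient i = (p C suc (toℕ i)) ℕ./ p

  binomialQuotient-zero : binomialQuotient Fin.zero ≡ 1
  binomialQuotient-zero = ≡.trans (≡.cong (ℕ._/ p) (nC1≡n p)) (n/n≡1 p)

  p*binomialQuotient : ∀ i → p ℕ.* binomialQuotient i ≡ p C suc (toℕ i)
  p*binomialQuotient i = m*[n/m]≡n (prime∣nCk p-prime (toℕ<n i))

  module _ {a ℓ} (S : CommutativeSemiring a ℓ) where
    open CommutativeSemiring S
    open CommutativeSemiringExp S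
    open CommutativeSemiringBinomial S
    open SemiringMult semiring using (×-homo-1; ×-assocˡ) renaming (_×_ to _×ⁿ_)
    open CommutativeMonoidMult +-commutativeMonoid using (×-distrib-+)
    open SemiringSum semiring
    open SetoidReasoning setoid

    middleTerms : Carrier → Carrier → Carrier
    middleTerms x y = sum (λ i → binomialQuotient i ×ⁿ (x ^ suc (toℕ i) * y ^ (suc m ∸ toℕ i)))

    ×-distrib-sum : ∀ n {k} (t : Vector Carrier k) → n ×ⁿ sum t ≈ sum (λ i → n ×ⁿ t i)
    ×-distrib-sum zero    {zero}  t = refl
    ×-distrib-sum (suc n) {zero}  t = trans (+-identityˡ _) (×-distrib-sum n t)
    ×-distrib-sum n       {suc k} t =
      trans (×-distrib-+ (t Fin.zero) _ n) (+-congˡ (×-distrib-sum n (tail t)))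

    -- Semirings are general enough for all three uses: `ℕ` for Fermat's little theorem, a ring of
    -- characteristic `q` for Frobenius, and the expansion of `(ϖ + 1) ^ p`.
    primeBinomial : ∀ x y → (x + y) ^ p ≈ y ^ p + (p ×ⁿ middleTerms x y + x ^ p)
    primeBinomial x y = begin
      (x + y) ^ p
        ≈⟨ theorem p x y ⟩
      binomialTerm x y p Fin.zero + sum (tail (binomialTerm x y p))
        ≈⟨ +-cong (trans (×-homo-1 _) (*-identityˡ _)) (sum-init-last (tail (binomialTerm x y p))) ⟩
      y ^ p + (sum (init (tail (binomialTerm x y p))) + last (tail (binomialTerm x y p)))
        ≈⟨ +-congˡ (+-cong middle final) ⟩
      y ^ p + (p ×ⁿ middleTerms x y + x ^ p) ∎
      where
      term : ℕ → ℕ → Carrier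
      term c k = c ×ⁿ (x ^ suc k * y ^ (suc m ∸ k))

      middle : sum (init (tail (binomialTerm x y p))) ≈ p ×ⁿ middleTerms x y
      middle = trans (sum-cong-≋ λ i → begin
          term (p C suc (toℕ (inject₁ i))) (toℕ (inject₁ i))
            ≡⟨ ≡.cong (λ k → term (p C suc k) k) (toℕ-inject₁ i) ⟩
          term (p C suc (toℕ i)) (toℕ i)
            ≡⟨ ≡.cong (λ c → term c (toℕ i)) (p*binomialQuotient i) ⟨
          term (p ℕ.* binomialQuotient i) (toℕ i)
            ≈⟨ ×-assocˡ _ p (binomialQuotient i) ⟨
          p ×ⁿ term (binomialQuotient i) (toℕ i) ∎)
        (sym (×-distrib-sum p {suc m} (λ i → term (binomialQuotient i) (toℕ i))))

      final : last (tail (binomialTerm x y p)) ≈ x ^ p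
      final = begin
        term (p C suc (toℕ (fromℕ (suc m)))) (toℕ (fromℕ (suc m)))
          ≡⟨ ≡.cong (λ k → term (p C suc k) k) (toℕ-fromℕ (suc m)) ⟩
        term (p C p) (suc m)
          ≡⟨ ≡.cong₂ (λ c k → c ×ⁿ (x ^ p * y ^ k)) (nCn≡1 p) (ℕ.n∸n≡0 m) ⟩
        1 ×ⁿ (x ^ p * 1#)
          ≈⟨ ×-homo-1 _ ⟩
        x ^ p * 1#
          ≈⟨ *-identityʳ _ ⟩
        x ^ p ∎

module ℕExp = CommutativeSemiringExp ℕ.+-*-commutativeSemiring

^-agrees : ∀ x n → x ℕExp.^ n ≡ x ℕ.^ n
^-agrees x zero    = ≡.refl
^-agrees x (suc n) = ≡.cong (x ℕ.*_) (^-agrees x n)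

×-agrees : ∀ n x → SemiringMult._×_ ℕ.+-*-semiring n x ≡ n ℕ.* x
×-agrees zero    x = ≡.refl
×-agrees (suc n) x = ≡.cong (x ℕ.+_) (×-agrees n x)

fermat : ∀ {p} → Prime p → ∀ n → ∃[ t ] n ℕ.^ p ≡ n ℕ.+ p ℕ.* t
fermat {zero}        p-prime n = contradiction p-prime ¬prime[0]
fermat {suc zero}    p-prime n = contradiction p-prime ¬prime[1]
fermat {suc (suc m)} p-prime zero    = 0 , ≡.sym (ℕ.*-zeroʳ m)
fermat {suc (suc m)} p-prime (suc n) with fermat p-prime n
... | t , n^p≡n+pt = M ℕ.+ t , (begin
  suc n ℕ.^ p                              ≡⟨ ^-agrees (suc n) p ⟨
  suc n ℕExp.^ p                           ≡⟨ primeBinomial ℕ.+-*-commutativeSemiring 1 n ⟩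
  n ℕExp.^ p ℕ.+ (p ×ⁿ M ℕ.+ 1 ℕExp.^ p)   ≡⟨ ≡.cong₂ ℕ._+_ (≡.trans (^-agrees n p) n^p≡n+pt)
                                                (≡.cong₂ ℕ._+_ (×-agrees p M) (≡.trans (^-agrees 1 p) (ℕ.^-zeroˡ p))) ⟩
  n ℕ.+ p ℕ.* t ℕ.+ (p ℕ.* M ℕ.+ 1)        ≡⟨ solve 4 (λ n p t M → n :+ p :* t :+ (p :* M :+ con 1)
                                                 := con 1 :+ n :+ p :* (M :+ t)) ≡.refl n p t M ⟩
  suc n ℕ.+ p ℕ.* (M ℕ.+ t)                ∎)
  where
  open ≡.≡-Reasoning
  open +-*-Solver
  open PrimeBinomial m p-prime
  open SemiringMult ℕ.+-*-semiring using () renaming (_×_ to _×ⁿ_)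
  p = suc (suc m)
  M = middleTerms ℕ.+-*-commutativeSemiring 1 n

-- Euclid's lemma removes the factor `n` from `n (n ^ p - 1)`, with the predecessor `s` of `n ^ p`
-- in place of a truncated subtraction. The multiple `t` is explicit because it reappears in an
-- exponent of `z`.
fermat′ : ∀ {p} → Prime (suc p) → ∀ n → ¬ (suc p ∣ n) → ∃[ t ] n ℕ.^ p ≡ 1 ℕ.+ suc p ℕ.* t
fermat′ {p} p-prime zero    p∤n = contradiction (ℕ∣._∣0 (suc p)) p∤n
fermat′ {p} p-prime (suc n) p∤n with suc n ℕ.^ p in n^p≡ | fermat p-prime (suc n)
... | zero  | _ = contradiction (≡.subst (ℕ._≤_ 1) n^p≡ (ℕ.m^n>0 (suc n) p)) λ ()
... | suc s | t , eq with euclidsLemma (suc n) s p-prime (ℕ∣.∣-trans (ℕ∣.m∣m*n t) (ℕ∣.∣-reflexive (≡.sym ns≡pt)))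
  where
  ns≡pt : suc n ℕ.* s ≡ suc p ℕ.* t
  ns≡pt = ℕ.+-cancelˡ-≡ (suc n) _ _ (≡.trans (≡.sym (ℕ.*-suc (suc n) s)) eq)
... | inj₁ p∣n          = contradiction p∣n p∤n
... | inj₂ (divides u s≡up) = u , ≡.cong suc (≡.trans s≡up (ℕ.*-comm u (suc p)))

-- Integer polynomials and the subrings ℤ[z]

module IntegerScalars {a ℓ} (R : CommutativeRing a ℓ) where
  open CommutativeRing R
  open IntegerMultiples +-abelianGroup using (_·_; ·-cong; ·-distribʳ; ·-assoc; neg-·)
  open CommutativeSemiringExp commutativeSemiring using (_^_)
  open SemiringMult semiring using (×-homo-1)
  open SemiringSum semiring
  open SetoidReasoning setoid

  infix 9 ⟨_⟩

  ⟨_⟩ : ℤ → Carrier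
  ⟨ i ⟩ = i · 1#

  ⟨⟩-+ : ∀ i j → ⟨ i ℤ.+ j ⟩ ≈ ⟨ i ⟩ + ⟨ j ⟩
  ⟨⟩-+ = ·-distribʳ 1#

  ·≈⟨⟩* : ∀ i x → i · x ≈ ⟨ i ⟩ * x
  ·≈⟨⟩* i x = sym (trans (·-assoc-* R i 1# x) (·-cong {i} ≡.refl (*-identityˡ x)))

  ⟨⟩-* : ∀ i j → ⟨ i ℤ.* j ⟩ ≈ ⟨ i ⟩ * ⟨ j ⟩
  ⟨⟩-* i j = trans (·-assoc i j 1#) (·≈⟨⟩* i ⟨ j ⟩)

  ⟨⟩-neg : ∀ i → ⟨ ℤ.- i ⟩ ≈ - ⟨ i ⟩
  ⟨⟩-neg i = neg-· i 1#

  ⟨1⟩ : ⟨ + 1 ⟩ ≈ 1#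
  ⟨1⟩ = ×-homo-1 1#

  ⟨⟩-^ : ∀ i n → ⟨ i ℤ.^ n ⟩ ≈ ⟨ i ⟩ ^ n
  ⟨⟩-^ i zero    = ⟨1⟩
  ⟨⟩-^ i (suc n) = trans (⟨⟩-* i (i ℤ.^ n)) (*-congˡ (⟨⟩-^ i n))

  1^n≈1 : ∀ n → 1# ^ n ≈ 1#
  1^n≈1 zero    = refl
  1^n≈1 (suc n) = trans (*-identityˡ _) (1^n≈1 n)

  -- Sends + 1 to 1# on the nose, so that the constants of the solver match the ring terms.
  private
    literal : ℤ → Carrier
    literal (+ 1) = 1#
    literal i     = ⟨ i ⟩

    literal≈ : ∀ i → literal i ≈ ⟨ i ⟩
    literal≈ (+ 0)           = refl
    literal≈ (+ 1)           = sym ⟨1⟩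
    literal≈ (+ suc (suc n)) = refl
    literal≈ -[1+ n ]        = refl

    homomorphic : ∀ {i} {x} → ⟨ i ⟩ ≈ x → literal i ≈ x
    homomorphic {i} = trans (literal≈ i)

    literal-homomorphism : ℤ.+-*-rawRing ACR.-Raw-AlmostCommutative⟶ ACR.fromCommutativeRing R
    literal-homomorphism = record
      { ⟦_⟧    = literal
      ; +-homo = λ i j → homomorphic {i ℤ.+ j} (trans (⟨⟩-+ i j) (sym (+-cong (literal≈ i) (literal≈ j))))
      ; *-homo = λ i j → homomorphic {i ℤ.* j} (trans (⟨⟩-* i j) (sym (*-cong (literal≈ i) (literal≈ j))))
      ; -‿homo = λ i → homomorphic {ℤ.- i} (trans (⟨⟩-neg i) (sym (-‿cong (literal≈ i))))
      ; 0-homo = refl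
      ; 1-homo = refl
      }

    literal≟ : ∀ i j → Maybe (literal i ≈ literal j)
    literal≟ i j with i ℤ.≟ j
    ... | yes ≡.refl = Maybe.just refl
    ... | no  _      = Maybe.nothing

  module Solver = RingSolver ℤ.+-*-rawRing (ACR.fromCommutativeRing R) literal-homomorphism literal≟

  open Solver using (solve; _:=_; _:+_; _:*_; :-_; con)

  poly : ∀ {n} → Vector ℤ n → Carrier → Carrier
  poly c x = sum (λ i → ⟨ c i ⟩ * x ^ toℕ i)

  poly-suc : ∀ {n} (c : Vector ℤ (suc n)) x → poly c x ≈ ⟨ c Fin.zero ⟩ + x * poly (tail c) x
  poly-suc {n} c x = +-cong (*-identityʳ _) (begin
    sum (λ i → ⟨ c (Fin.suc i) ⟩ * (x * x ^ toℕ i))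
      ≈⟨ sum-cong-≋ {n} (λ i → solve 3 (λ c x y → c :* (x :* y) := x :* (c :* y)) refl ⟨ c (Fin.suc i) ⟩ x (x ^ toℕ i)) ⟩
    sum (λ i → x * (⟨ c (Fin.suc i) ⟩ * x ^ toℕ i))
      ≈⟨ *-distribˡ-sum x (λ i → ⟨ tail c i ⟩ * x ^ toℕ i) ⟨
    x * poly (tail c) x ∎)

  poly-cong : ∀ {n} {c d : Vector ℤ n} x → (∀ i → c i ≡ d i) → poly c x ≈ poly d x
  poly-cong x c≗d = sum-cong-≋ (λ i → *-congʳ (reflexive (≡.cong ⟨_⟩ (c≗d i))))

  poly-+ : ∀ {n} (c d : Vector ℤ n) x → poly (λ i → c i ℤ.+ d i) x ≈ poly c x + poly d x
  poly-+ c d x = trans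
    (sum-cong-≋ (λ i → trans (*-congʳ (⟨⟩-+ (c i) (d i))) (distribʳ (x ^ toℕ i) ⟨ c i ⟩ ⟨ d i ⟩)))
    (∑-distrib-+ (λ i → ⟨ c i ⟩ * x ^ toℕ i) (λ i → ⟨ d i ⟩ * x ^ toℕ i))

  poly-scale : ∀ {n} i (c : Vector ℤ n) x → poly (λ j → i ℤ.* c j) x ≈ ⟨ i ⟩ * poly c x
  poly-scale i c x = trans
    (sum-cong-≋ (λ j → trans (*-congʳ (⟨⟩-* i (c j))) (*-assoc ⟨ i ⟩ ⟨ c j ⟩ (x ^ toℕ j))))
    (sym (*-distribˡ-sum ⟨ i ⟩ (λ j → ⟨ c j ⟩ * x ^ toℕ j)))

  poly-0 : ∀ n x → poly {n} (λ _ → + 0) x ≈ 0#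
  poly-0 n x = trans (sum-cong-≋ {n} (λ i → zeroˡ (x ^ toℕ i))) (sum-replicate-zero n)

  poly-init-last : ∀ {n} (c : Vector ℤ (suc n)) x → poly c x ≈ poly (init c) x + ⟨ last c ⟩ * x ^ n
  poly-init-last {n} c x = trans (sum-init-last (λ i → ⟨ c i ⟩ * x ^ toℕ i)) (+-cong
    (sum-cong-≋ {n} (λ i → *-congˡ (reflexive (≡.cong (x ^_) (toℕ-inject₁ i)))))
    (*-congˡ (reflexive (≡.cong (x ^_) (toℕ-fromℕ n)))))

  monic : ∀ {n} → Vector ℤ n → Carrier → Carrier
  monic {n} c x = x ^ n + poly c x

  monic-suc : ∀ {n} (c : Vector ℤ (suc n)) x → monic c x ≈ ⟨ c Fin.zero ⟩ + x * monic (tail c) x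
  monic-suc {n} c x = trans (+-congˡ (poly-suc c x))
    (solve 4 (λ x y c p → x :* y :+ (c :+ x :* p) := c :+ x :* (y :+ p)) refl x (x ^ n) _ _)

  monic≈ : ∀ {n} (c : Vector ℤ n) x → x ^ n + sum (λ i → c i · x ^ toℕ i) ≈ monic c x
  monic≈ c x = +-congˡ (sum-cong-≋ (λ i → ·≈⟨⟩* (c i) (x ^ toℕ i)))

  -- Membership records how an element is built from `z`, so that spanning, the action of Frobenius
  -- and divisibility by `Δ z` can be proved by recursion on it.
  data ℤ[_] (z : Carrier) : Carrier → Set (a ⊔ ℓ) where
    gen  : ℤ[ z ] z
    one  : ℤ[ z ] 1#
    add  : ∀ {x y} → ℤ[ z ] x → ℤ[ z ] y → ℤ[ z ] (x + y)
    neg  : ∀ {x} → ℤ[ z ] x → ℤ[ z ] (- x)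
    mul  : ∀ {x y} → ℤ[ z ] x → ℤ[ z ] y → ℤ[ z ] (x * y)
    resp : ∀ {x y} → x ≈ y → ℤ[ z ] x → ℤ[ z ] y

  module _ {z : Carrier} where

    ℤ[]-0 : ℤ[ z ] 0#
    ℤ[]-0 = resp (-‿inverseʳ 1#) (add one (neg one))

    ℤ[]-⟨+⟩ : ∀ n → ℤ[ z ] ⟨ + n ⟩
    ℤ[]-⟨+⟩ zero    = ℤ[]-0
    ℤ[]-⟨+⟩ (suc n) = add one (ℤ[]-⟨+⟩ n)

    ℤ[]-⟨⟩ : ∀ i → ℤ[ z ] ⟨ i ⟩
    ℤ[]-⟨⟩ (+ n)    = ℤ[]-⟨+⟩ n
    ℤ[]-⟨⟩ -[1+ n ] = neg (ℤ[]-⟨+⟩ (suc n))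

    ℤ[]-^ : ∀ {x} n → ℤ[ z ] x → ℤ[ z ] (x ^ n)
    ℤ[]-^ zero    s = one
    ℤ[]-^ (suc n) s = mul s (ℤ[]-^ n s)

    ℤ[]-poly : ∀ {n x} (c : Vector ℤ n) → ℤ[ z ] x → ℤ[ z ] (poly c x)
    ℤ[]-poly {zero}  c s = ℤ[]-0
    ℤ[]-poly {suc n} c s = resp (sym (poly-suc c _))
      (add (ℤ[]-⟨⟩ (c Fin.zero)) (mul s (ℤ[]-poly (tail c) s)))

    ℤ[]-monic : ∀ {n x} (c : Vector ℤ n) → ℤ[ z ] x → ℤ[ z ] (monic c x)
    ℤ[]-monic {n} c s = add (ℤ[]-^ n s) (ℤ[]-poly c s)

    ℤ[]-trans : ∀ {x y} → ℤ[ z ] x → ℤ[ x ] y → ℤ[ z ] y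
    ℤ[]-trans s gen          = s
    ℤ[]-trans s one          = one
    ℤ[]-trans s (add t u)    = add (ℤ[]-trans s t) (ℤ[]-trans s u)
    ℤ[]-trans s (neg t)      = neg (ℤ[]-trans s t)
    ℤ[]-trans s (mul t u)    = mul (ℤ[]-trans s t) (ℤ[]-trans s u)
    ℤ[]-trans s (resp x≈y t) = resp x≈y (ℤ[]-trans s t)

  -- Turns the cofactor produced by `monic-scaled` into an integer when `x` is one.
  ℤ[⟨⟩]⇒⟨⟩ : ∀ {i x} → ℤ[ ⟨ i ⟩ ] x → ∃[ j ] x ≈ ⟨ j ⟩
  ℤ[⟨⟩]⇒⟨⟩ {i} gen = i , refl
  ℤ[⟨⟩]⇒⟨⟩ {i} one = + 1 , sym ⟨1⟩
  ℤ[⟨⟩]⇒⟨⟩ {i} (add s t) with ℤ[⟨⟩]⇒⟨⟩ {i} s | ℤ[⟨⟩]⇒⟨⟩ {i} t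
  ... | j , x≈j | k , y≈k = j ℤ.+ k , trans (+-cong x≈j y≈k) (sym (⟨⟩-+ j k))
  ℤ[⟨⟩]⇒⟨⟩ {i} (neg s) with ℤ[⟨⟩]⇒⟨⟩ {i} s
  ... | j , x≈j = ℤ.- j , trans (-‿cong x≈j) (sym (⟨⟩-neg j))
  ℤ[⟨⟩]⇒⟨⟩ {i} (mul s t) with ℤ[⟨⟩]⇒⟨⟩ {i} s | ℤ[⟨⟩]⇒⟨⟩ {i} t
  ... | j , x≈j | k , y≈k = j ℤ.* k , trans (*-cong x≈j y≈k) (sym (⟨⟩-* j k))
  ℤ[⟨⟩]⇒⟨⟩ {i} (resp x≈y s) with ℤ[⟨⟩]⇒⟨⟩ {i} s
  ... | j , x≈j = j , trans (sym x≈y) x≈j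

  -- Clearing denominators in a monic polynomial at `y = x / q` leaves a factor `q` in every term
  -- but the leading one. The cofactor `w` lies in `ℤ[x]` and not merely in the ring, which is what
  -- makes the result usable modulo `q ℤ[z]`.
  monic-scaled : ∀ q {x y} → ⟨ q ⟩ * y ≈ x → ∀ {n} (c : Vector ℤ n) →
                 ∃[ w ] ℤ[ x ] w × ⟨ q ⟩ ^ n * monic c y ≈ x ^ n + ⟨ q ⟩ * w
  monic-scaled q {x} {y} qy≈x {zero} c = 0# , ℤ[]-0 ,
    solve 1 (λ q → con (+ 1) :* (con (+ 1) :+ con (+ 0)) := con (+ 1) :+ q :* con (+ 0)) refl ⟨ q ⟩
  monic-scaled q {x} {y} qy≈x {suc n} c with monic-scaled q qy≈x (tail c)
  ... | w , s , eq = Q * c₀ + x * w , add (mul (ℤ[]-^ n (ℤ[]-⟨⟩ q)) (ℤ[]-⟨⟩ (c Fin.zero))) (mul gen s) , (begin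
    ⟨ q ⟩ * Q * monic c y
      ≈⟨ *-congˡ (monic-suc c y) ⟩
    ⟨ q ⟩ * Q * (c₀ + y * M)
      ≈⟨ solve 5 (λ q Q c₀ y M → q :* Q :* (c₀ :+ y :* M) := q :* (Q :* c₀) :+ q :* y :* (Q :* M)) refl ⟨ q ⟩ Q c₀ y M ⟩
    ⟨ q ⟩ * (Q * c₀) + ⟨ q ⟩ * y * (Q * M)
      ≈⟨ +-congˡ (*-cong qy≈x eq) ⟩
    ⟨ q ⟩ * (Q * c₀) + x * (x ^ n + ⟨ q ⟩ * w)
      ≈⟨ solve 5 (λ q A x X w → q :* A :+ x :* (X :+ q :* w) := x :* X :+ q :* (A :+ x :* w)) refl ⟨ q ⟩ (Q * c₀) x (x ^ n) w ⟩
    x * x ^ n + ⟨ q ⟩ * (Q * c₀ + x * w) ∎)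
    where
    Q = ⟨ q ⟩ ^ n
    c₀ = ⟨ c Fin.zero ⟩
    M = monic (tail c) y

-- Frobenius on `ℤ[z]` modulo a prime

module Frobenius {a ℓ} (B : CommutativeRing a ℓ) {q : ℕ} (q-prime : Prime q)
                 (char-q : CommutativeRing._≈_ B
                   (SemiringMult._×_ (CommutativeRing.semiring B) q (CommutativeRing.1# B)) (CommutativeRing.0# B)) where
  open CommutativeRing B
  open CommutativeSemiringExp commutativeSemiring
  open SemiringMult semiring using (×-assoc-*; ×-congʳ) renaming (_×_ to _×ⁿ_)
  open AbelianGroupProperties +-abelianGroup using (identityʳ-unique; inverseˡ-unique)
  open SetoidReasoning setoid

  private
    q×≈0 : ∀ x → q ×ⁿ x ≈ 0#
    q×≈0 x = begin
      q ×ⁿ x           ≈⟨ ×-congʳ q (*-identityˡ x) ⟨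
      q ×ⁿ (1# * x)    ≈⟨ ×-assoc-* q 1# x ⟨
      q ×ⁿ 1# * x      ≈⟨ *-congʳ char-q ⟩
      0# * x           ≈⟨ zeroˡ x ⟩
      0#               ∎

  ^q-+ : ∀ x y → (x + y) ^ q ≈ x ^ q + y ^ q
  ^q-+ = additive q q-prime q×≈0
    where
    -- The prime becomes a variable here so that it can be matched as `suc (suc m)`; `q` is a fixed
    -- module parameter.
    additive : ∀ n → Prime n → (∀ x → n ×ⁿ x ≈ 0#) → ∀ x y → (x + y) ^ n ≈ x ^ n + y ^ n
    additive zero            n-prime _    = contradiction n-prime ¬prime[0]
    additive (suc zero)      n-prime _    = contradiction n-prime ¬prime[1]
    additive n@(suc (suc m)) n-prime n×≈0 x y = begin
      (x + y) ^ n              ≈⟨ primeBinomial commutativeSemiring x y ⟩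
      y ^ n + (n ×ⁿ M + x ^ n) ≈⟨ +-congˡ (trans (+-congʳ (n×≈0 M)) (+-identityˡ _)) ⟩
      y ^ n + x ^ n            ≈⟨ +-comm _ _ ⟩
      x ^ n + y ^ n            ∎
      where
      open PrimeBinomial m n-prime
      M = middleTerms commutativeSemiring x y

  ^qᵏ-+ : ∀ k x y → (x + y) ^ (q ℕ.^ k) ≈ x ^ (q ℕ.^ k) + y ^ (q ℕ.^ k)
  ^qᵏ-+ zero    x y = trans (*-identityʳ _) (sym (+-cong (*-identityʳ x) (*-identityʳ y)))
  ^qᵏ-+ (suc k) x y = begin
    (x + y) ^ (q ℕ.* Q)            ≈⟨ ^-assocʳ (x + y) q Q ⟨
    ((x + y) ^ q) ^ Q              ≈⟨ ^-congˡ Q (^q-+ x y) ⟩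
    (x ^ q + y ^ q) ^ Q            ≈⟨ ^qᵏ-+ k (x ^ q) (y ^ q) ⟩
    (x ^ q) ^ Q + (y ^ q) ^ Q      ≈⟨ +-cong (^-assocʳ x q Q) (^-assocʳ y q Q) ⟩
    x ^ (q ℕ.* Q) + y ^ (q ℕ.* Q)  ∎
    where Q = q ℕ.^ k

  -- Additivity makes this power equal to its own double, so the exponent need not be inspected.
  ^qᵏ-0 : ∀ k → 0# ^ (q ℕ.^ k) ≈ 0#
  ^qᵏ-0 k = identityʳ-unique _ _ (trans (sym (^qᵏ-+ k 0# 0#)) (^-congˡ (q ℕ.^ k) (+-identityˡ 0#)))

  ^qᵏ-neg : ∀ k x → (- x) ^ (q ℕ.^ k) ≈ - (x ^ (q ℕ.^ k))
  ^qᵏ-neg k x = inverseˡ-unique _ _ (begin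
    (- x) ^ (q ℕ.^ k) + x ^ (q ℕ.^ k)   ≈⟨ ^qᵏ-+ k (- x) x ⟨
    (- x + x) ^ (q ℕ.^ k)               ≈⟨ ^-congˡ (q ℕ.^ k) (-‿inverseˡ x) ⟩
    0# ^ (q ℕ.^ k)                      ≈⟨ ^qᵏ-0 k ⟩
    0#                                  ∎)

module SubringQuotient {a ℓ} (R : CommutativeRing a ℓ) (z : CommutativeRing.Carrier R) (q : ℤ) where
  open CommutativeRing R
  open IntegerScalars R
  open Solver using (solve; _:=_; _:+_; _:*_; _:-_; :-_; con)

  infix 4 _∼_

  -- Congruence modulo `q ℤ[z]`, not modulo `q R`: whether a multiple of `q` in `R` vanishes here is
  -- precisely the question to be settled.
  record _∼_ (X Y : Σ Carrier ℤ[ z ]) : Set (a ⊔ ℓ) where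
    constructor by
    field
      quotient   : Carrier
      quotient∈  : ℤ[ z ] quotient
      difference : proj₁ X ≈ proj₁ Y + ⟨ q ⟩ * quotient

  lift : ∀ {X Y} → proj₁ X ≈ proj₁ Y → X ∼ Y
  lift {X} {Y} x≈y = by 0# ℤ[]-0
    (trans x≈y (solve 2 (λ y q → y := y :+ q :* con (+ 0)) refl (proj₁ Y) ⟨ q ⟩))

  ℤ[z]/q : CommutativeRing (a ⊔ ℓ) (a ⊔ ℓ)
  ℤ[z]/q = record
    { Carrier = Σ Carrier ℤ[ z ]
    ; _≈_ = _∼_
    ; _+_ = λ (x , s) (y , t) → x + y , add s t
    ; _*_ = λ (x , s) (y , t) → x * y , mul s t
    ; -_  = λ (x , s) → - x , neg s
    ; 0#  = 0# , ℤ[]-0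
    ; 1#  = 1# , one
    ; isCommutativeRing = record
      { isRing = record
        { +-isAbelianGroup = record
          { isGroup = record
            { isMonoid = record
              { isSemigroup = record
                { isMagma = record
                  { isEquivalence = record
                    { refl  = lift refl
                    ; sym   = λ { {x , _} {y , _} (by w s x≈) → by (- w) (neg s) (trans
                        (solve 3 (λ y q w → y := y :+ q :* w :+ q :* (:- w)) refl y ⟨ q ⟩ w)
                        (+-congʳ (sym x≈))) }
                    ; trans = λ { {x , _} {y , _} {v , _} (by w s x≈) (by w′ s′ y≈) → by (w + w′) (add s s′) (trans x≈
                        (trans (+-congʳ y≈)
                          (solve 4 (λ v q w w′ → v :+ q :* w′ :+ q :* w := v :+ q :* (w :+ w′)) refl v ⟨ q ⟩ w w′))) }
                    }
                  ; ∙-cong = λ { {x , _} {y , _} {u , _} {v , _} (by w s x≈) (by w′ s′ u≈) → by (w + w′) (add s s′) (trans (+-cong x≈ u≈)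
                      (solve 5 (λ y v q w w′ → (y :+ q :* w) :+ (v :+ q :* w′) := y :+ v :+ q :* (w :+ w′)) refl y v ⟨ q ⟩ w w′)) }
                  }
                ; assoc = λ _ _ _ → lift (+-assoc _ _ _)
                }
              ; identity = (λ _ → lift (+-identityˡ _)) , (λ _ → lift (+-identityʳ _))
              }
            ; inverse = (λ _ → lift (-‿inverseˡ _)) , (λ _ → lift (-‿inverseʳ _))
            ; ⁻¹-cong = λ { {x , _} {y , _} (by w s x≈) → by (- w) (neg s) (trans (-‿cong x≈)
                (solve 3 (λ y q w → :- (y :+ q :* w) := (:- y) :+ q :* (:- w)) refl y ⟨ q ⟩ w)) }
            }
          ; comm = λ _ _ → lift (+-comm _ _)
          }
        ; *-cong = λ { {x , _} {y , t} {u , r} {v , _} (by w s x≈) (by w′ s′ u≈) →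
            by (w * u + y * w′) (add (mul s r) (mul t s′)) (trans (*-congʳ x≈)
              (trans (distribʳ u y (⟨ q ⟩ * w)) (trans (+-congʳ (*-congˡ u≈))
                (solve 6 (λ y v q w w′ u → y :* (v :+ q :* w′) :+ q :* w :* u := y :* v :+ q :* (w :* u :+ y :* w′)) refl y v ⟨ q ⟩ w w′ u)))) }
        ; *-assoc = λ _ _ _ → lift (*-assoc _ _ _)
        ; *-identity = (λ _ → lift (*-identityˡ _)) , (λ _ → lift (*-identityʳ _))
        ; distrib = (λ _ _ _ → lift (distribˡ _ _ _)) , (λ _ _ _ → lift (distribʳ _ _ _))
        }
      ; *-comm = λ _ _ → lift (*-comm _ _)
      }
    }

module PrimeDenominator {a ℓ} (R : CommutativeRing a ℓ) (z : CommutativeRing.Carrier R) {q : ℕ} (q-prime : Prime q) where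
  open CommutativeRing R
  open CommutativeSemiringExp commutativeSemiring using (_^_)
  open SemiringMult semiring using () renaming (_×_ to _×ⁿ_)
  open IntegerScalars R
  open SubringQuotient R z (+ q)
  open Solver using (solve; _:=_; _:+_; _:*_; :-_; con)

  private
    module B = CommutativeRing ℤ[z]/q
    module B^ = CommutativeSemiringExp B.commutativeSemiring
    module B× = SemiringMult B.semiring

    proj₁-× : ∀ n → proj₁ (n B×.× B.1#) ≡ n ×ⁿ 1#
    proj₁-× zero    = ≡.refl
    proj₁-× (suc n) = ≡.cong (λ x → 1# + x) (proj₁-× n)

    proj₁-^ : ∀ x n → proj₁ (x B^.^ n) ≡ proj₁ x ^ n
    proj₁-^ x zero    = ≡.refl
    proj₁-^ x (suc n) = ≡.cong (proj₁ x *_) (proj₁-^ x n)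

    open Frobenius ℤ[z]/q q-prime
      (by 1# one (trans (reflexive (proj₁-× q)) (solve 1 (λ q → q := con (+ 0) :+ q :* con (+ 1)) refl ⟨ + q ⟩)))

  -- An iterate of Frobenius is a ring endomorphism of the quotient, so fixing the generator is
  -- enough.
  ^qᵏ-fixes : ∀ k → z ^ (q ℕ.^ k) ≈ z → ∀ {x} (s : ℤ[ z ] x) → (x , s) B^.^ (q ℕ.^ k) ∼ (x , s)
  ^qᵏ-fixes k z-fixed gen          = lift (trans (reflexive (proj₁-^ _ (q ℕ.^ k))) z-fixed)
  ^qᵏ-fixes k z-fixed one          = B.trans (B^.^-congˡ (q ℕ.^ k) (lift refl)) (B.trans (IntegerScalars.1^n≈1 ℤ[z]/q (q ℕ.^ k)) (lift refl))
  ^qᵏ-fixes k z-fixed (add s t)    = B.trans (^qᵏ-+ k (_ , s) (_ , t)) (B.+-cong (^qᵏ-fixes k z-fixed s) (^qᵏ-fixes k z-fixed t))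
  ^qᵏ-fixes k z-fixed (neg s)      = B.trans (^qᵏ-neg k (_ , s)) (B.-‿cong (^qᵏ-fixes k z-fixed s))
  ^qᵏ-fixes k z-fixed (mul s t)    = B.trans (B^.^-distrib-* (_ , s) (_ , t) (q ℕ.^ k)) (B.*-cong (^qᵏ-fixes k z-fixed s) (^qᵏ-fixes k z-fixed t))
  ^qᵏ-fixes k z-fixed (resp x≈y s) = B.trans (B^.^-congˡ (q ℕ.^ k) (lift (sym x≈y))) (B.trans (^qᵏ-fixes k z-fixed s) (lift x≈y))

  -- x = q y is nilpotent modulo q ℤ[z], but also fixed by a high power of Frobenius.
  divisible : ∀ k → z ^ (q ℕ.^ k) ≈ z → ∀ {x y} → ℤ[ z ] x → ⟨ + q ⟩ * y ≈ x →
              ∀ {n} (c : Vector ℤ n) → monic c y ≈ 0# → n ℕ.≤ q ℕ.^ k →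
              ∃[ w ] ℤ[ z ] w × x ≈ ⟨ + q ⟩ * w
  divisible k z-fixed {x} {y} s qy≈x {n} c c[y]≈0 n≤Q with monic-scaled (+ q) qy≈x c
  ... | w , t , eq = quotient , quotient∈ , trans difference (+-identityˡ _)
    where
    X : B.Carrier
    X = x , s

    Xⁿ∼0 : X B^.^ n ∼ B.0#
    Xⁿ∼0 = by (- w) (neg (ℤ[]-trans s t)) (trans (reflexive (proj₁-^ X n)) (trans
      (solve 3 (λ A q w → A := A :+ q :* w :+ q :* (:- w)) refl (x ^ n) ⟨ + q ⟩ w)
      (+-congʳ (trans (sym eq) (trans (*-congˡ c[y]≈0) (zeroʳ _))))))

    X∼0 : X ∼ B.0#
    X∼0 = begin
      X                                    ≈⟨ ^qᵏ-fixes k z-fixed s ⟨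
      X B^.^ Q                             ≡⟨ ≡.cong (X B^.^_) (ℕ.m+[n∸m]≡n n≤Q) ⟨
      X B^.^ (n ℕ.+ (Q ∸ n))               ≈⟨ B^.^-homo-* X n (Q ∸ n) ⟩
      (X B^.^ n) B.* (X B^.^ (Q ∸ n))      ≈⟨ B.*-congʳ Xⁿ∼0 ⟩
      B.0# B.* (X B^.^ (Q ∸ n))            ≈⟨ B.zeroˡ _ ⟩
      B.0#                                 ∎
      where
      open SetoidReasoning B.setoid
      Q = q ℕ.^ k

    open _∼_ X∼0

-- Cyclotomic integers

∣^∣ : ∀ i n → ℤ.∣ i ℤ.^ n ∣ ≡ ℤ.∣ i ∣ ℕ.^ n
∣^∣ i zero    = ≡.refl
∣^∣ i (suc n) = ≡.trans (ℤ.abs-* i (i ℤ.^ n)) (≡.cong (ℤ.∣ i ∣ ℕ.*_) (∣^∣ i n))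

i+qj≡0⇒q∣i : ∀ {i j q} → i ℤ.+ + q ℤ.* j ≡ + 0 → q ∣ ℤ.∣ i ∣
i+qj≡0⇒q∣i {i} {j} {q} i+qj≡0 = divides ℤ.∣ j ∣ (begin
  ℤ.∣ i ∣                 ≡⟨ ≡.cong ℤ.∣_∣ (AbelianGroupProperties.inverseˡ-unique ℤ.+-0-abelianGroup i (+ q ℤ.* j) i+qj≡0) ⟩
  ℤ.∣ ℤ.- (+ q ℤ.* j) ∣   ≡⟨ ℤ.∣-i∣≡∣i∣ (+ q ℤ.* j) ⟩
  ℤ.∣ + q ℤ.* j ∣         ≡⟨ ℤ.abs-* (+ q) j ⟩
  q ℕ.* ℤ.∣ j ∣           ≡⟨ ℕ.*-comm q ℤ.∣ j ∣ ⟩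
  ℤ.∣ j ∣ ℕ.* q           ∎)
  where open ≡.≡-Reasoning

module _ {a ℓ} (R : CommutativeRing a ℓ) where
  open CommutativeRing R
  open IntegerScalars R

  -- A disjunction in the conclusion would amount to deciding equality with zero; as a premise,
  -- `x ≉ 0` keeps the property provable from a tight apartness.
  NoZeroDivisors : Set (a ⊔ ℓ)
  NoZeroDivisors = ∀ {x y} → x * y ≈ 0# → ¬ (x ≈ 0#) → y ≈ 0#

  AllIntegral : Set (a ⊔ ℓ)
  AllIntegral = ∀ x → ∃[ n ] Σ[ c ∈ Vector ℤ n ] monic c x ≈ 0#

module IntegralDomain {a ℓ} (R : CommutativeRing a ℓ)
  (noZeroDivisors : NoZeroDivisors R) (characteristicZero : CharacteristicZero R)
  where

  open CommutativeRing R
  open IntegerScalars R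
  open AbelianGroupProperties +-abelianGroup using (⁻¹-involutive; ε⁻¹≈ε)
  open Solver using (solve; _:=_; _:+_; _:*_; _:-_; :-_; con)

  *-cancelˡ : ∀ {x y w} → ¬ (x ≈ 0#) → x * y ≈ x * w → y ≈ w
  *-cancelˡ {x} {y} {w} x≉0 xy≈xw = trans
    (solve 2 (λ y w → y := (y :- w) :+ w) refl y w)
    (trans (+-congʳ (noZeroDivisors x[y-w]≈0 x≉0)) (+-identityˡ w))
    where
    x[y-w]≈0 : x * (y - w) ≈ 0#
    x[y-w]≈0 = trans (solve 3 (λ x y w → x :* (y :- w) := x :* y :- x :* w) refl x y w)
      (trans (+-congʳ xy≈xw) (-‿inverseʳ _))

  ⟨⟩≈0⇒≡0 : ∀ {i} → ⟨ i ⟩ ≈ 0# → i ≡ + 0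
  ⟨⟩≈0⇒≡0 {+ n}      n≈0  = ≡.cong +_ (characteristicZero n n≈0)
  ⟨⟩≈0⇒≡0 { -[1+ n ]} -n≈0 =
    contradiction (characteristicZero (suc n) (trans (sym (⁻¹-involutive _)) (trans (-‿cong -n≈0) ε⁻¹≈ε))) λ ()

  ⟨⟩*-cancelˡ : ∀ {i x y} → i ≢ + 0 → ⟨ i ⟩ * x ≈ ⟨ i ⟩ * y → x ≈ y
  ⟨⟩*-cancelˡ i≢0 = *-cancelˡ (i≢0 ∘ ⟨⟩≈0⇒≡0)

module CyclotomicIntegers {a ℓ} (R : CommutativeRing a ℓ)
  (noZeroDivisors : NoZeroDivisors R) (characteristicZero : CharacteristicZero R) (integral : AllIntegral R)
  (m : ℕ) (p-prime : Prime (suc (suc m)))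
  (z : CommutativeRing.Carrier R) (z-primitive : IsPrimitiveRootOfUnity R (suc (suc m)) z)
  where

  open CommutativeRing R
  open CommutativeSemiringExp commutativeSemiring
  open IntegerScalars R
  open IntegralDomain R noZeroDivisors characteristicZero
  open PrimeBinomial m p-prime
  open SemiringMult semiring using () renaming (_×_ to _×ⁿ_)
  open SemiringSum semiring
  open AbelianGroupProperties +-abelianGroup using (inverseʳ-unique; identityʳ-unique)
  open Solver using (solve; _:=_; _:+_; _:*_; _:-_; :-_; con)
  open SetoidReasoning setoid

  n = suc m
  p = suc n

  ϖ : Carrier
  ϖ = z - 1#

  z^p≈1 : z ^ p ≈ 1#
  z^p≈1 = proj₁ z-primitive

  z≉1 : ¬ (z ≈ 1#)
  z≉1 z≈1 = proj₂ z-primitive 1 (ℕ.s≤s ℕ.z≤n) (ℕ.s≤s (ℕ.s≤s ℕ.z≤n)) (trans (*-identityʳ z) z≈1)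

  ϖ≉0 : ¬ (ϖ ≈ 0#)
  ϖ≉0 ϖ≈0 = z≉1 (trans (solve 1 (λ z → z := z :- con (+ 1) :+ con (+ 1)) refl z) (trans (+-congʳ ϖ≈0) (+-identityˡ 1#)))

  quotients : Vector ℤ n
  quotients i = + binomialQuotient i

  η : Carrier
  η = poly quotients ϖ

  η≈1+ϖ* : η ≈ 1# + ϖ * poly (tail quotients) ϖ
  η≈1+ϖ* = trans (poly-suc quotients ϖ)
    (+-congʳ (trans (reflexive (≡.cong (λ k → ⟨ + k ⟩) binomialQuotient-zero)) ⟨1⟩))

  -- Expanding 1 = z ^ p = (ϖ + 1) ^ p and dividing by ϖ.
  ϖⁿ≈-pη : ϖ ^ n ≈ - (⟨ + p ⟩ * η)
  ϖⁿ≈-pη = inverseʳ-unique _ _ (*-cancelˡ ϖ≉0 (trans (identityʳ-unique 1# _ (begin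
    1# + ϖ * (⟨ + p ⟩ * η + ϖ ^ n)
      ≈⟨ +-congˡ (solve 4 (λ ϖ p e E → ϖ :* (p :* e :+ E) := p :* (ϖ :* e) :+ ϖ :* E) refl ϖ ⟨ + p ⟩ η (ϖ ^ n)) ⟩
    1# + (⟨ + p ⟩ * (ϖ * η) + ϖ ^ p)
      ≈⟨ +-cong (1^n≈1 p) (+-congʳ (trans (·≈⟨⟩* (+ p) _) (*-congˡ middle))) ⟨
    1# ^ p + (p ×ⁿ middleTerms commutativeSemiring ϖ 1# + ϖ ^ p)
      ≈⟨ primeBinomial commutativeSemiring ϖ 1# ⟨
    (ϖ + 1#) ^ p
      ≈⟨ ^-congˡ p (solve 1 (λ z → z :- con (+ 1) :+ con (+ 1) := z) refl z) ⟩
    z ^ p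
      ≈⟨ z^p≈1 ⟩
    1# ∎)) (sym (zeroʳ ϖ))))
    where
    middle : middleTerms commutativeSemiring ϖ 1# ≈ ϖ * η
    middle = trans
      (sum-cong-≋ {n} (λ i → trans (·≈⟨⟩* (quotients i) _) (trans
        (*-congˡ (trans (*-congˡ (1^n≈1 (n ∸ toℕ i))) (*-identityʳ _)))
        (solve 3 (λ q x y → q :* (x :* y) := x :* (q :* y)) refl ⟨ quotients i ⟩ ϖ (ϖ ^ toℕ i)))))
      (sym (*-distribˡ-sum ϖ (λ i → ⟨ quotients i ⟩ * ϖ ^ toℕ i)))

  -- The rational root argument: an integral equation of `y = b / q`, scaled by `q ^ N`, reads
  -- `b ^ N + q t = 0` with `t` an integer, and `ℤ` embeds in `R`.
  ⟨⟩∣⇒∣ : ∀ {q b y} → Prime q → ⟨ b ⟩ ≈ ⟨ + q ⟩ * y → q ∣ ℤ.∣ b ∣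
  ⟨⟩∣⇒∣ {q} {b} {y} q-prime b≈qy
    with N , c , c[y]≈0 ← integral y
    with w , s , eq ← monic-scaled (+ q) (sym b≈qy) c
    with t , w≈t ← ℤ[⟨⟩]⇒⟨⟩ {b} s
    = prime∣^⇒∣ q-prime ℤ.∣ b ∣ N (≡.subst (q ∣_) (∣^∣ b N)
        (i+qj≡0⇒q∣i {b ℤ.^ N} {t} (⟨⟩≈0⇒≡0 bᴺ+qt≈0)))
    where
    bᴺ+qt≈0 : ⟨ b ℤ.^ N ℤ.+ + q ℤ.* t ⟩ ≈ 0#
    bᴺ+qt≈0 = begin
      ⟨ b ℤ.^ N ℤ.+ + q ℤ.* t ⟩     ≈⟨ ⟨⟩-+ (b ℤ.^ N) (+ q ℤ.* t) ⟩
      ⟨ b ℤ.^ N ⟩ + ⟨ + q ℤ.* t ⟩   ≈⟨ +-cong (⟨⟩-^ b N) (⟨⟩-* (+ q) t) ⟩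
      ⟨ b ⟩ ^ N + ⟨ + q ⟩ * ⟨ t ⟩   ≈⟨ +-congˡ (*-congˡ w≈t) ⟨
      ⟨ b ⟩ ^ N + ⟨ + q ⟩ * w       ≈⟨ eq ⟨
      ⟨ + q ⟩ ^ N * monic c y       ≈⟨ *-congˡ c[y]≈0 ⟩
      ⟨ + q ⟩ ^ N * 0#              ≈⟨ zeroʳ _ ⟩
      0#                            ∎

  -- If ϖ divides b, then p divides bⁿ.
  ϖ∣⇒p∣ : ∀ {b x} → ⟨ b ⟩ ≈ ϖ * x → p ∣ ℤ.∣ b ∣
  ϖ∣⇒p∣ {b} {x} b≈ϖx = prime∣^⇒∣ p-prime ℤ.∣ b ∣ n
    (≡.subst (p ∣_) (∣^∣ b n) (⟨⟩∣⇒∣ {b = b ℤ.^ n} p-prime (begin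
      ⟨ b ℤ.^ n ⟩                   ≈⟨ ⟨⟩-^ b n ⟩
      ⟨ b ⟩ ^ n                     ≈⟨ ^-congˡ n b≈ϖx ⟩
      (ϖ * x) ^ n                   ≈⟨ ^-distrib-* ϖ x n ⟩
      ϖ ^ n * x ^ n                 ≈⟨ *-congʳ ϖⁿ≈-pη ⟩
      - (⟨ + p ⟩ * η) * x ^ n       ≈⟨ solve 3 (λ p e x → (:- (p :* e)) :* x := p :* ((:- e) :* x)) refl ⟨ + p ⟩ η (x ^ n) ⟩
      ⟨ + p ⟩ * (- η * x ^ n)       ∎)))

  -- η is congruent to 1 modulo ϖ, and multiplication by it turns p into a multiple of ϖⁿ, so the
  -- coefficients can be read off one power of ϖ at a time.
  ϖ-adic : ∀ {k} → k ℕ.≤ n → (b : Vector ℤ k) → ∀ {y} → poly b ϖ * η ≈ ϖ ^ k * y → ∀ i → (+ p) ℤ∣.∣ b i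
  ϖ-adic {suc k} k<n b {y} eq = λ where
      Fin.zero    → p∣b₀
      (Fin.suc i) → ϖ-adic (ℕ.<⇒≤ k<n) (tail b) tail-eq i
    where
    b₀ = ⟨ b Fin.zero ⟩
    P  = poly (tail b) ϖ
    T  = poly (tail quotients) ϖ
    -- The power of `ϖ` left when `ϖ ^ suc k` is taken out of `ϖ ^ n`; the subtraction is exact
    -- because `suc k ≤ n`.
    e  = n ∸ suc k

    [b₀+ϖP]η≈ϖϖᵏy : (b₀ + ϖ * P) * η ≈ ϖ * (ϖ ^ k * y)
    [b₀+ϖP]η≈ϖϖᵏy = trans (*-congʳ (sym (poly-suc b ϖ))) (trans eq (*-assoc _ _ _))

    b₀≈ : b₀ ≈ ϖ * (ϖ ^ k * y - P * η - b₀ * T)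
    b₀≈ = begin
      b₀
        ≈⟨ solve 4 (λ b ϖ P E → b := (b :+ ϖ :* P) :* E :- ϖ :* (P :* E) :- b :* (E :- con (+ 1))) refl b₀ ϖ P η ⟩
      (b₀ + ϖ * P) * η - ϖ * (P * η) - b₀ * (η - 1#)
        ≈⟨ +-cong (+-congʳ [b₀+ϖP]η≈ϖϖᵏy) (-‿cong (*-congˡ (+-congʳ η≈1+ϖ*))) ⟩
      ϖ * (ϖ ^ k * y) - ϖ * (P * η) - b₀ * (1# + ϖ * T - 1#)
        ≈⟨ solve 5 (λ b ϖ Y Q T → ϖ :* Y :- ϖ :* Q :- b :* (con (+ 1) :+ ϖ :* T :- con (+ 1))
             := ϖ :* (Y :- Q :- b :* T)) refl b₀ ϖ (ϖ ^ k * y) (P * η) T ⟩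
      ϖ * (ϖ ^ k * y - P * η - b₀ * T) ∎

    p∣b₀ : (+ p) ℤ∣.∣ b Fin.zero
    p∣b₀ = ℤ∣.∣ᵤ⇒∣ (ϖ∣⇒p∣ {b = b Fin.zero} b₀≈)

    open ℤ∣._∣_ p∣b₀ using (quotient; equality)

    b₀/p = ⟨ quotient ⟩

    b₀≈qp : b₀ ≈ b₀/p * ⟨ + p ⟩
    b₀≈qp = trans (reflexive (≡.cong ⟨_⟩ equality)) (⟨⟩-* quotient (+ p))

    ϖⁿ≈ : ϖ * ϖ ^ k * ϖ ^ e ≈ ϖ ^ n
    ϖⁿ≈ = trans (sym (^-homo-* ϖ (suc k) e)) (^-congʳ ϖ (ℕ.m+[n∸m]≡n k<n))

    tail-eq : P * η ≈ ϖ ^ k * (y + b₀/p * ϖ ^ e)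
    tail-eq = *-cancelˡ ϖ≉0 (begin
      ϖ * (P * η)
        ≈⟨ solve 4 (λ b ϖ P E → ϖ :* (P :* E) := (b :+ ϖ :* P) :* E :- b :* E) refl b₀ ϖ P η ⟩
      (b₀ + ϖ * P) * η - b₀ * η
        ≈⟨ +-cong [b₀+ϖP]η≈ϖϖᵏy (-‿cong (*-congʳ b₀≈qp)) ⟩
      ϖ * (ϖ ^ k * y) - b₀/p * ⟨ + p ⟩ * η
        ≈⟨ +-congˡ (solve 3 (λ q p E → :- (q :* p :* E) := q :* (:- (p :* E))) refl b₀/p ⟨ + p ⟩ η) ⟩
      ϖ * (ϖ ^ k * y) + b₀/p * - (⟨ + p ⟩ * η)
        ≈⟨ +-congˡ (*-congˡ (trans ϖⁿ≈ ϖⁿ≈-pη)) ⟨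
      ϖ * (ϖ ^ k * y) + b₀/p * (ϖ * ϖ ^ k * ϖ ^ e)
        ≈⟨ solve 5 (λ ϖ K y q e → ϖ :* (K :* y) :+ q :* (ϖ :* K :* e) := ϖ :* (K :* (y :+ q :* e))) refl ϖ (ϖ ^ k) y b₀/p (ϖ ^ e) ⟩
      ϖ * (ϖ ^ k * (y + b₀/p * ϖ ^ e)) ∎)

  -- Multiplying by `η` trades the factor `p` for `ϖ ^ n`, the case `k = n` of `ϖ-adic`, without
  -- inverting `η`.
  p∣poly⇒p∣coefficients : (b : Vector ℤ n) → ∀ {y} → poly b ϖ ≈ ⟨ + p ⟩ * y → ∀ i → (+ p) ℤ∣.∣ b i
  p∣poly⇒p∣coefficients b {y} eq = ϖ-adic ℕ.≤-refl b (begin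
    poly b ϖ * η            ≈⟨ *-congʳ eq ⟩
    ⟨ + p ⟩ * y * η         ≈⟨ solve 3 (λ p y e → p :* y :* e := (:- (p :* e)) :* (:- y)) refl ⟨ + p ⟩ y η ⟩
    - (⟨ + p ⟩ * η) * - y   ≈⟨ *-congʳ ϖⁿ≈-pη ⟨
    ϖ ^ n * - y             ∎)

  poly-quotient : (b : Vector ℤ n) → ∀ {y} → poly b ϖ ≈ ⟨ + p ⟩ * y →
                  Σ[ c ∈ Vector ℤ n ] (∀ i → b i ≡ + p ℤ.* c i) × poly c ϖ ≈ y
  poly-quotient b eq = c , b≡pc , ⟨⟩*-cancelˡ {+ p} (λ ())
      (trans (sym (poly-scale (+ p) c ϖ)) (trans (sym (poly-cong ϖ b≡pc)) eq))
    where
    p∣b = p∣poly⇒p∣coefficients b eq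
    c : Vector ℤ n
    c i = ℤ∣._∣_.quotient (p∣b i)
    b≡pc : ∀ i → b i ≡ + p ℤ.* c i
    b≡pc i = ≡.trans (ℤ∣._∣_.equality (p∣b i)) (ℤ.*-comm (c i) (+ p))

  -- Descent: zero is a multiple of `p`, so a relation is `p` times an integer vector that is again
  -- a relation.
  poly≈0⇒pᵏ∣ : ∀ k (b : Vector ℤ n) → poly b ϖ ≈ 0# → ∀ i → p ℕ.^ k ∣ ℤ.∣ b i ∣
  poly≈0⇒pᵏ∣ zero    b b[ϖ]≈0 i = ℕ∣.1∣ _
  poly≈0⇒pᵏ∣ (suc k) b b[ϖ]≈0 i = ≡.subst (p ℕ.^ suc k ∣_) p*∣cᵢ∣≡∣bᵢ∣
    (ℕ∣.*-monoʳ-∣ p (poly≈0⇒pᵏ∣ k c c[ϖ]≈0 i))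
    where
    b/p = poly-quotient b (trans b[ϖ]≈0 (sym (zeroʳ ⟨ + p ⟩)))
    c = proj₁ b/p
    c[ϖ]≈0 = proj₂ (proj₂ b/p)

    p*∣cᵢ∣≡∣bᵢ∣ : p ℕ.* ℤ.∣ c i ∣ ≡ ℤ.∣ b i ∣
    p*∣cᵢ∣≡∣bᵢ∣ = ≡.sym (≡.trans (≡.cong ℤ.∣_∣ (proj₁ (proj₂ b/p) i)) (ℤ.abs-* (+ p) (c i)))

  powers-independent : (b : Vector ℤ n) → poly b ϖ ≈ 0# → ∀ i → b i ≡ + 0
  -- The coefficient's absolute value is itself the number of descent steps, which is already too
  -- many unless it is zero.
  powers-independent b b[ϖ]≈0 i = ℤ.∣i∣≡0⇒i≡0 (small⇒0 ℤ.∣ b i ∣ (poly≈0⇒pᵏ∣ ℤ.∣ b i ∣ b b[ϖ]≈0 i))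
    where
    small⇒0 : ∀ k → p ℕ.^ k ∣ k → k ≡ 0
    small⇒0 zero    _    = ≡.refl
    small⇒0 (suc k) pᵏ∣k = contradiction (ℕ∣.∣⇒≤ pᵏ∣k) (ℕ.<⇒≱ (n<2+k^n m (suc k)))

  -- `ℤ[z]` as the integer span of the powers of `ϖ`

  Spanned : Carrier → Set ℓ
  Spanned x = Σ[ c ∈ Vector ℤ n ] x ≈ poly c ϖ

  spanned-resp : ∀ {x y} → x ≈ y → Spanned x → Spanned y
  spanned-resp x≈y (c , x≈c) = c , trans (sym x≈y) x≈c

  spanned-+ : ∀ {x y} → Spanned x → Spanned y → Spanned (x + y)
  spanned-+ (c , x≈c) (d , y≈d) = (λ i → c i ℤ.+ d i) , trans (+-cong x≈c y≈d) (sym (poly-+ c d ϖ))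

  spanned-⟨⟩* : ∀ i {x} → Spanned x → Spanned (⟨ i ⟩ * x)
  spanned-⟨⟩* i (c , x≈c) = (λ j → i ℤ.* c j) , trans (*-congˡ x≈c) (sym (poly-scale i c ϖ))

  spanned-1 : Spanned 1#
  spanned-1 = c , sym (trans (poly-suc c ϖ) (trans (+-cong ⟨1⟩ (trans (*-congˡ (poly-0 m ϖ)) (zeroʳ ϖ))) (+-identityʳ 1#)))
    where
    c : Vector ℤ n
    c Fin.zero    = + 1
    c (Fin.suc i) = + 0

  -- Shifting the coefficients creates one term in `ϖ ^ n`, which folds back to `- p η`, a
  -- combination of lower powers.
  spanned-ϖ* : ∀ {x} → Spanned x → Spanned (ϖ * x)
  spanned-ϖ* {x} (c , x≈c) = spanned-resp (begin
      poly (init c⁺) ϖ + ⟨ last c⁺ ⟩ * (⟨ ℤ.- (+ p) ⟩ * η)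
        ≈⟨ +-congˡ (*-congˡ -pη≈ϖⁿ) ⟩
      poly (init c⁺) ϖ + ⟨ last c⁺ ⟩ * ϖ ^ n
        ≈⟨ poly-init-last c⁺ ϖ ⟨
      poly c⁺ ϖ
        ≈⟨ trans (poly-suc c⁺ ϖ) (+-identityˡ _) ⟩
      ϖ * poly c ϖ
        ≈⟨ *-congˡ x≈c ⟨
      ϖ * x ∎)
    (spanned-+ (init c⁺ , refl) (spanned-⟨⟩* (last c⁺) (spanned-⟨⟩* (ℤ.- (+ p)) (quotients , refl))))
    where
    c⁺ : Vector ℤ (suc n)
    c⁺ Fin.zero    = + 0
    c⁺ (Fin.suc i) = c i

    -pη≈ϖⁿ : ⟨ ℤ.- (+ p) ⟩ * η ≈ ϖ ^ n
    -pη≈ϖⁿ = trans (*-congʳ (⟨⟩-neg (+ p)))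
      (trans (solve 2 (λ p e → (:- p) :* e := :- (p :* e)) refl ⟨ + p ⟩ η) (sym ϖⁿ≈-pη))

  spanned-poly* : ∀ {k} (c : Vector ℤ k) {x} → Spanned x → Spanned (poly c ϖ * x)
  spanned-poly* {zero}  c {x} s = spanned-resp refl (spanned-⟨⟩* (+ 0) s)
  spanned-poly* {suc k} c {x} s = spanned-resp
    (trans (solve 4 (λ c ϖ P x → c :* x :+ ϖ :* (P :* x) := (c :+ ϖ :* P) :* x) refl ⟨ c Fin.zero ⟩ ϖ (poly (tail c) ϖ) x)
      (*-congʳ (sym (poly-suc c ϖ))))
    (spanned-+ (spanned-⟨⟩* (c Fin.zero) s) (spanned-ϖ* (spanned-poly* (tail c) s)))

  ℤ[z]-spanned : ∀ {x} → ℤ[ z ] x → Spanned x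
  ℤ[z]-spanned gen = spanned-resp (solve 1 (λ z → (z :- con (+ 1)) :* con (+ 1) :+ con (+ 1) := z) refl z)
    (spanned-+ (spanned-ϖ* spanned-1) spanned-1)
  ℤ[z]-spanned one          = spanned-1
  ℤ[z]-spanned (add s t)    = spanned-+ (ℤ[z]-spanned s) (ℤ[z]-spanned t)
  ℤ[z]-spanned (neg {x} s)  = spanned-resp
    (trans (*-congʳ (trans (⟨⟩-neg (+ 1)) (-‿cong ⟨1⟩))) (solve 1 (λ x → (:- con (+ 1)) :* x := :- x) refl x))
    (spanned-⟨⟩* (ℤ.- (+ 1)) (ℤ[z]-spanned s))
  ℤ[z]-spanned (mul s t) with ℤ[z]-spanned s
  ... | c , x≈c = spanned-resp (*-congʳ (sym x≈c)) (spanned-poly* c (ℤ[z]-spanned t))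
  ℤ[z]-spanned (resp x≈y s) = spanned-resp x≈y (ℤ[z]-spanned s)

  -- Saturation: cancelling integer factors from members of `ℤ[z]`

  ϖ∈ℤ[z] : ℤ[ z ] ϖ
  ϖ∈ℤ[z] = add gen (neg one)

  p-saturated : ∀ {y} → ℤ[ z ] (⟨ + p ⟩ * y) → ℤ[ z ] y
  p-saturated s = resp (proj₂ (proj₂ b/p)) (ℤ[]-poly (proj₁ b/p) ϖ∈ℤ[z])
    where
    spanned = ℤ[z]-spanned s
    b/p = poly-quotient (proj₁ spanned) (sym (proj₂ spanned))

  z^[1+pt]≈z : ∀ t → z ^ (1 ℕ.+ p ℕ.* t) ≈ z
  z^[1+pt]≈z t = trans (*-congˡ (trans (sym (^-assocʳ z p t)) (trans (^-congˡ t z^p≈1) (1^n≈1 t)))) (*-identityʳ z)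

  z^-iterate : ∀ {Q} → z ^ Q ≈ z → ∀ k → z ^ (Q ℕ.^ k) ≈ z
  z^-iterate z^Q≈z zero    = *-identityʳ z
  z^-iterate {Q} z^Q≈z (suc k) =
    trans (sym (^-assocʳ z Q (Q ℕ.^ k))) (trans (^-congˡ (Q ℕ.^ k) z^Q≈z) (z^-iterate z^Q≈z k))

  q-saturated : ∀ {q} → Prime q → ¬ (p ∣ q) → ∀ {y} → ℤ[ z ] (⟨ + q ⟩ * y) → ℤ[ z ] y
  q-saturated {zero}      q-prime = contradiction q-prime ¬prime[0]
  q-saturated {suc zero}  q-prime = contradiction q-prime ¬prime[1]
  q-saturated {q@(suc (suc r))} q-prime p∤q {y} s =
      resp (sym (⟨⟩*-cancelˡ {+ q} (λ ()) (proj₂ (proj₂ qy∈qℤ[z])))) (proj₁ (proj₂ qy∈qℤ[z]))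
    where
    equation = integral y
    N = proj₁ equation

    q^n≡1+pt = fermat′ p-prime q p∤q

    -- By Fermat `q ^ n` is `1` modulo the order `p` of `z`, so raising to it fixes `z`. Iterating
    -- `N` times keeps this and pushes the total exponent past the degree `N`, as `divisible`
    -- requires.
    z-fixed : z ^ (q ℕ.^ (n ℕ.* N)) ≈ z
    z-fixed = trans (^-congʳ z (≡.sym (ℕ.^-*-assoc q n N)))
      (z^-iterate (trans (^-congʳ z (proj₂ q^n≡1+pt)) (z^[1+pt]≈z (proj₁ q^n≡1+pt))) N)

    qy∈qℤ[z] = PrimeDenominator.divisible R z q-prime (n ℕ.* N) z-fixed s refl
      (proj₁ (proj₂ equation)) (proj₂ (proj₂ equation))
      (ℕ.≤-trans (ℕ.m≤n*m N n) (ℕ.<⇒≤ (n<2+k^n r (n ℕ.* N))))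

  prime-saturated : ∀ {q} → Prime q → ∀ {y} → ℤ[ z ] (⟨ + q ⟩ * y) → ℤ[ z ] y
  prime-saturated {q} q-prime with p ℕ.≟ q
  ... | yes ≡.refl = p-saturated
  ... | no  p≢q    = q-saturated q-prime λ p∣q →
    [ (λ p≡1 → contradiction (≡.subst Prime p≡1 p-prime) ¬prime[1]) , p≢q ]′ (prime⇒irreducible q-prime p∣q)

  product-saturated : ∀ {qs} → All Prime qs → ∀ {y} → ℤ[ z ] (⟨ + product qs ⟩ * y) → ℤ[ z ] y
  product-saturated []                          s = resp (trans (*-congʳ ⟨1⟩) (*-identityˡ _)) s
  product-saturated {q ∷ qs} (q-prime ∷ primes) s = product-saturated primes (prime-saturated q-prime
    (resp (trans (*-congʳ (trans (reflexive (≡.cong ⟨_⟩ (ℤ.pos-* q (product qs)))) (⟨⟩-* (+ q) (+ product qs)))) (*-assoc _ _ _)) s))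

  saturated : ∀ {i} → i ≢ + 0 → ∀ {y} → ℤ[ z ] (⟨ i ⟩ * y) → ℤ[ z ] y
  saturated {+ zero}     i≢0 s = contradiction ≡.refl i≢0
  saturated {+ suc k}    i≢0 s = product-saturated factorsPrime
    (≡.subst (λ k → ℤ[ z ] (⟨ + k ⟩ * _)) isFactorisation s)
    where open PrimeFactorisation (factorise (suc k))
  saturated { -[1+ k ]} i≢0 {y} s = saturated {+ suc k} (λ ())
    (resp (solve 2 (λ k y → :- ((:- k) :* y) := k :* y) refl ⟨ + suc k ⟩ y) (neg s))

-- Elements of the cyclotomic field as fractions

module CyclotomicField {k ℓ₁ ℓ₂ a ℓ} (K : HeytingField k ℓ₁ ℓ₂) (ζ : HeytingField.Carrier K) (m : ℕ)
  (p-prime : Prime (suc (suc m))) (isCyclotomic : IsCyclotomicField K (suc (suc m)) ζ)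
  (O : CommutativeRing a ℓ) (ι : CommutativeRing.Carrier O → HeytingField.Carrier K)
  (isRingOfIntegers : IsRingOfIntegers O K ι) where

  private
    module K where
      open HeytingField K using (_#_; tight; #⇒invertible) public
      open CommutativeRing (fieldRing K) public
      open CommutativeSemiringExp commutativeSemiring public
      open IntegerScalars (fieldRing K) public
      open SetoidReasoning setoid public
      open Solver public using (solve; _:=_; _:+_; _:*_; _:-_; :-_; con)

    open CommutativeRing O
    open CommutativeSemiringExp commutativeSemiring
    open IntegerScalars O
    open IsCyclotomicField isCyclotomic
    open IsRingOfIntegers isRingOfIntegers renaming (integral to integral-K)
    open IsRingMonomorphism isRingMonomorphism

    p = suc (suc m)

  -- By tightness it suffices to refute `y # 0`; such a `y` would be invertible and force `x` to
  -- vanish.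
  field-noZeroDivisors : NoZeroDivisors (fieldRing K)
  field-noZeroDivisors {x} {y} xy≈0 x≉0 = proj₁ (K.tight y K.0#) λ y#0 → x≉0 (helper (K.#⇒invertible y#0))
    where
    helper : ∃[ v ] (v K.* (y K.- K.0#) K.≈ K.1#) × ((y K.- K.0#) K.* v K.≈ K.1#) → x K.≈ K.0#
    helper (v , vy≈1 , _) = K.begin
      x                        K.≈⟨ K.*-identityˡ x ⟨
      K.1# K.* x               K.≈⟨ K.*-congʳ vy≈1 ⟨
      v K.* (y K.- K.0#) K.* x K.≈⟨ K.solve 3 (λ v x y → v K.:* (y K.:- K.con (+ 0)) K.:* x K.:= v K.:* (x K.:* y)) K.refl v x y ⟩
      v K.* (x K.* y)          K.≈⟨ K.*-congˡ xy≈0 ⟩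
      v K.* K.0#               K.≈⟨ K.zeroʳ v ⟩
      K.0#                     K.∎

  private
    module KD = IntegralDomain (fieldRing K) field-noZeroDivisors characteristicZero

  ι-injective-0 : ∀ {x} → ι x K.≈ K.0# → x ≈ 0#
  ι-injective-0 ιx≈0 = injective (K.trans ιx≈0 (K.sym 0#-homo))

  ι-cong-0 : ∀ {x} → x ≈ 0# → ι x K.≈ K.0#
  ι-cong-0 x≈0 = K.trans (⟦⟧-cong x≈0) 0#-homo

  noZeroDivisors : NoZeroDivisors O
  noZeroDivisors xy≈0 x≉0 = ι-injective-0
    (field-noZeroDivisors (K.trans (K.sym (*-homo _ _)) (ι-cong-0 xy≈0)) (x≉0 ∘ ι-injective-0))

  ι-⟨+⟩ : ∀ n → ι ⟨ + n ⟩ K.≈ K.⟨ + n ⟩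
  ι-⟨+⟩ zero    = 0#-homo
  ι-⟨+⟩ (suc n) = K.trans (+-homo 1# ⟨ + n ⟩) (K.+-cong 1#-homo (ι-⟨+⟩ n))

  ι-⟨⟩ : ∀ i → ι ⟨ i ⟩ K.≈ K.⟨ i ⟩
  ι-⟨⟩ (+ n)    = ι-⟨+⟩ n
  ι-⟨⟩ -[1+ n ] = K.trans (-‿homo ⟨ + suc n ⟩) (K.-‿cong (ι-⟨+⟩ (suc n)))

  ι-^ : ∀ x n → ι (x ^ n) K.≈ ι x K.^ n
  ι-^ x zero    = 1#-homo
  ι-^ x (suc n) = K.trans (*-homo x (x ^ n)) (K.*-congˡ (ι-^ x n))

  ι-poly : ∀ {n} (c : Vector ℤ n) x → ι (poly c x) K.≈ K.poly c (ι x)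
  ι-poly {zero}  c x = 0#-homo
  ι-poly {suc n} c x = K.begin
    ι (poly c x)                                     K.≈⟨ ⟦⟧-cong (poly-suc c x) ⟩
    ι (⟨ c Fin.zero ⟩ + x * poly (tail c) x)         K.≈⟨ +-homo _ _ ⟩
    ι ⟨ c Fin.zero ⟩ K.+ ι (x * poly (tail c) x)     K.≈⟨ K.+-cong (ι-⟨⟩ (c Fin.zero)) (K.trans (*-homo _ _) (K.*-congˡ (ι-poly (tail c) x))) ⟩
    K.⟨ c Fin.zero ⟩ K.+ ι x K.* K.poly (tail c) (ι x) K.≈⟨ K.poly-suc c (ι x) ⟨
    K.poly c (ι x)                                   K.∎

  characteristicZero-O : CharacteristicZero O
  characteristicZero-O n n≈0 = characteristicZero n (K.trans (K.sym (ι-⟨+⟩ n)) (ι-cong-0 n≈0))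

  integral : AllIntegral O
  integral x with integral-K x
  ... | n , c , eq = n , c , ι-injective-0 (K.trans (+-homo _ _)
    (K.trans (K.+-cong (ι-^ x n) (ι-poly c x)) (K.trans (K.sym (K.monic≈ c (ι x))) eq)))

  ζ-integral : IsAlgebraicInteger (fieldRing K) ζ
  ζ-integral = p , c , K.trans (K.monic≈ c ζ) (K.begin
    ζ K.^ p K.+ K.poly c ζ
      K.≈⟨ K.+-cong (proj₁ primitiveRoot) (K.poly-suc c ζ) ⟩
    K.1# K.+ (K.⟨ -[1+ 0 ] ⟩ K.+ ζ K.* K.poly (tail c) ζ)
      K.≈⟨ K.+-congˡ (K.+-cong (K.-‿cong K.⟨1⟩) (K.*-congˡ (K.poly-0 (suc m) ζ))) ⟩
    K.1# K.+ (K.- K.1# K.+ ζ K.* K.0#)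
      K.≈⟨ K.solve 1 (λ ζ → K.con (+ 1) K.:+ (K.:- K.con (+ 1) K.:+ ζ K.:* K.con (+ 0)) K.:= K.con (+ 0)) K.refl ζ ⟩
    K.0# K.∎)
    where
    -- The lower coefficients of `X ^ p - 1`; the leading one is implicit.
    c : Vector ℤ p
    c Fin.zero    = -[1+ 0 ]
    c (Fin.suc i) = + 0

  z : Carrier
  z = proj₁ (complete ζ ζ-integral)

  ιz≈ζ : ι z K.≈ ζ
  ιz≈ζ = proj₂ (complete ζ ζ-integral)

  z-primitive : IsPrimitiveRootOfUnity O p z
  z-primitive =
      injective (K.trans (ι[z^ p ]≈ζ^) (K.trans (proj₁ primitiveRoot) (K.sym 1#-homo)))
    , λ k 0<k k<p z^k≈1 → proj₂ primitiveRoot k 0<k k<p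
        (K.trans (K.sym ι[z^ k ]≈ζ^) (K.trans (⟦⟧-cong z^k≈1) 1#-homo))
    where
    ι[z^_]≈ζ^ : ∀ k → ι (z ^ k) K.≈ ζ K.^ k
    ι[z^ k ]≈ζ^ = K.trans (ι-^ z k) (K.^-congˡ k ιz≈ζ)

  -- The image in `K` of `ℤ[z]` localised at the non-zero integers. Only integers serve as
  -- denominators, since these are what `saturated` can remove.
  Fraction : K.Carrier → Set _
  Fraction x = ∃[ d ] d ≢ + 0 × (∃[ w ] ℤ[ z ] w × K.⟨ d ⟩ K.* x K.≈ ι w)

  ι-⟨⟩* : ∀ i x → ι (⟨ i ⟩ * x) K.≈ K.⟨ i ⟩ K.* ι x
  ι-⟨⟩* i x = K.trans (*-homo _ _) (K.*-congʳ (ι-⟨⟩ i))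

  *-≢0 : ∀ {d e} → d ≢ + 0 → e ≢ + 0 → d ℤ.* e ≢ + 0
  *-≢0 {d} d≢0 e≢0 de≡0 = [ d≢0 , e≢0 ]′ (ℤ.i*j≡0⇒i≡0∨j≡0 d de≡0)

  module _ {y w d} (d≢0 : d ≢ + 0) (w∈ℤ[z] : ℤ[ z ] w) (wy≈d : ι w K.* y K.≈ K.⟨ d ⟩) where

    -- The factor `w` is cancelled by multiplying with `y`, which replaces it by the non-zero
    -- integer `d`.
    monic-tail : ∀ {n} (c : Vector ℤ (suc n)) → c Fin.zero ≡ + 0 → monic c w ≈ 0# → monic (tail c) w ≈ 0#
    monic-tail c c₀≡0 c[w]≈0 = ι-injective-0 (KD.⟨⟩*-cancelˡ d≢0 (K.begin
      K.⟨ d ⟩ K.* ι M                 K.≈⟨ K.*-congʳ wy≈d ⟨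
      ι w K.* y K.* ι M               K.≈⟨ K.solve 3 (λ w y M → w K.:* y K.:* M K.:= y K.:* (w K.:* M)) K.refl (ι w) y (ι M) ⟩
      y K.* (ι w K.* ι M)             K.≈⟨ K.*-congˡ (K.trans (K.sym (*-homo w M)) (ι-cong-0 wM≈0)) ⟩
      y K.* K.0#                      K.≈⟨ K.trans (K.zeroʳ y) (K.sym (K.zeroʳ K.⟨ d ⟩)) ⟩
      K.⟨ d ⟩ K.* K.0#                K.∎))
      where
      M = monic (tail c) w
      wM≈0 : w * M ≈ 0#
      wM≈0 = trans (sym (trans (monic-suc c w) (trans (+-congʳ (reflexive (≡.cong ⟨_⟩ c₀≡0))) (+-identityˡ (w * M))))) c[w]≈0

    -- Multiplying `c₀ + w M = 0` by `y` and using `w y = d` gives `c₀ y = - d M`, so `c₀` is a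
    -- denominator.
    fraction-monic : ∀ {n} (c : Vector ℤ (suc n)) → c Fin.zero ≢ + 0 → monic c w ≈ 0# → Fraction y
    fraction-monic c c₀≢0 c[w]≈0 = c Fin.zero , c₀≢0 , - (⟨ d ⟩ * M) , neg (mul (ℤ[]-⟨⟩ d) (ℤ[]-monic (tail c) w∈ℤ[z])) , (K.begin
      c₀ K.* y
        K.≈⟨ K.solve 4 (λ c y w M → c K.:* y K.:= (c K.:+ w K.:* M) K.:* y K.:- w K.:* y K.:* M) K.refl c₀ y (ι w) (ι M) ⟩
      (c₀ K.+ ι w K.* ι M) K.* y K.- ι w K.* y K.* ι M
        K.≈⟨ K.+-cong (K.trans (K.*-congʳ c₀+wM≈0) (K.zeroˡ y)) (K.-‿cong (K.*-congʳ wy≈d)) ⟩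
      K.0# K.- K.⟨ d ⟩ K.* ι M
        K.≈⟨ K.+-identityˡ _ ⟩
      K.- (K.⟨ d ⟩ K.* ι M)
        K.≈⟨ K.-‿cong (ι-⟨⟩* d M) ⟨
      K.- ι (⟨ d ⟩ * M)
        K.≈⟨ -‿homo (⟨ d ⟩ * M) ⟨
      ι (- (⟨ d ⟩ * M)) K.∎)
      where
      M = monic (tail c) w
      c₀ = K.⟨ c Fin.zero ⟩
      c₀+wM≈0 : c₀ K.+ ι w K.* ι M K.≈ K.0#
      c₀+wM≈0 = K.trans (K.sym (K.trans (+-homo ⟨ c Fin.zero ⟩ (w * M)) (K.+-cong (ι-⟨⟩ (c Fin.zero)) (*-homo w M))))
        (ι-cong-0 (trans (sym (monic-suc c w)) c[w]≈0))

    -- An integral equation of w, divided by the power of w in its lowest term, expresses the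
    -- inverse of w.
    fraction-inv : ∀ {n} (c : Vector ℤ n) → monic c w ≈ 0# → Fraction y
    fraction-inv {zero}  c 1≈0    = contradiction (characteristicZero-O 1 1≈0) λ ()
    fraction-inv {suc n} c c[w]≈0 = by-lowest (c Fin.zero ℤ.≟ + 0)
      where
      by-lowest : Dec (c Fin.zero ≡ + 0) → Fraction y
      by-lowest (yes c₀≡0) = fraction-inv (tail c) (monic-tail c c₀≡0 c[w]≈0)
      by-lowest (no  c₀≢0) = fraction-monic c c₀≢0 c[w]≈0

  fraction-+ : ∀ {x y} → Fraction x → Fraction y → Fraction (x K.+ y)
  fraction-+ {x} {y} (d , d≢0 , v , s , dx≈v) (e , e≢0 , w , t , ey≈w) =
    d ℤ.* e , *-≢0 d≢0 e≢0 , ⟨ e ⟩ * v + ⟨ d ⟩ * w , add (mul (ℤ[]-⟨⟩ e) s) (mul (ℤ[]-⟨⟩ d) t) , (K.begin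
      K.⟨ d ℤ.* e ⟩ K.* (x K.+ y)
        K.≈⟨ K.*-congʳ (K.⟨⟩-* d e) ⟩
      K.⟨ d ⟩ K.* K.⟨ e ⟩ K.* (x K.+ y)
        K.≈⟨ K.solve 4 (λ d e x y → d K.:* e K.:* (x K.:+ y) K.:= e K.:* (d K.:* x) K.:+ d K.:* (e K.:* y)) K.refl K.⟨ d ⟩ K.⟨ e ⟩ x y ⟩
      K.⟨ e ⟩ K.* (K.⟨ d ⟩ K.* x) K.+ K.⟨ d ⟩ K.* (K.⟨ e ⟩ K.* y)
        K.≈⟨ K.+-cong (K.*-congˡ dx≈v) (K.*-congˡ ey≈w) ⟩
      K.⟨ e ⟩ K.* ι v K.+ K.⟨ d ⟩ K.* ι w
        K.≈⟨ K.+-cong (ι-⟨⟩* e v) (ι-⟨⟩* d w) ⟨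
      ι (⟨ e ⟩ * v) K.+ ι (⟨ d ⟩ * w)
        K.≈⟨ +-homo (⟨ e ⟩ * v) (⟨ d ⟩ * w) ⟨
      ι (⟨ e ⟩ * v + ⟨ d ⟩ * w) K.∎)

  fraction-neg : ∀ {x} → Fraction x → Fraction (K.- x)
  fraction-neg {x} (d , d≢0 , v , s , dx≈v) = d , d≢0 , - v , neg s ,
    K.trans (K.solve 2 (λ d x → d K.:* (K.:- x) K.:= K.:- (d K.:* x)) K.refl K.⟨ d ⟩ x)
      (K.trans (K.-‿cong dx≈v) (K.sym (-‿homo v)))

  fraction-* : ∀ {x y} → Fraction x → Fraction y → Fraction (x K.* y)
  fraction-* {x} {y} (d , d≢0 , v , s , dx≈v) (e , e≢0 , w , t , ey≈w) =
    d ℤ.* e , *-≢0 d≢0 e≢0 , v * w , mul s t , (K.begin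
      K.⟨ d ℤ.* e ⟩ K.* (x K.* y)
        K.≈⟨ K.*-congʳ (K.⟨⟩-* d e) ⟩
      K.⟨ d ⟩ K.* K.⟨ e ⟩ K.* (x K.* y)
        K.≈⟨ K.solve 4 (λ d e x y → d K.:* e K.:* (x K.:* y) K.:= d K.:* x K.:* (e K.:* y)) K.refl K.⟨ d ⟩ K.⟨ e ⟩ x y ⟩
      K.⟨ d ⟩ K.* x K.* (K.⟨ e ⟩ K.* y)
        K.≈⟨ K.*-cong dx≈v ey≈w ⟩
      ι v K.* ι w
        K.≈⟨ *-homo v w ⟨
      ι (v * w) K.∎)

  fraction-⁻¹ : ∀ {x y} → x K.* y K.≈ K.1# → Fraction x → Fraction y
  fraction-⁻¹ {x} {y} xy≈1 (d , d≢0 , w , s , dx≈w) =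
    fraction-inv d≢0 s wy≈d (proj₁ (proj₂ (integral w))) (proj₂ (proj₂ (integral w)))
    where
    wy≈d : ι w K.* y K.≈ K.⟨ d ⟩
    wy≈d = K.begin
      ι w K.* y             K.≈⟨ K.*-congʳ dx≈w ⟨
      K.⟨ d ⟩ K.* x K.* y   K.≈⟨ K.*-assoc K.⟨ d ⟩ x y ⟩
      K.⟨ d ⟩ K.* (x K.* y) K.≈⟨ K.*-congˡ xy≈1 ⟩
      K.⟨ d ⟩ K.* K.1#      K.≈⟨ K.*-identityʳ K.⟨ d ⟩ ⟩
      K.⟨ d ⟩               K.∎

  fraction-resp : ∀ {x y} → x K.≈ y → Fraction x → Fraction y
  fraction-resp x≈y (d , d≢0 , w , s , dx≈w) = d , d≢0 , w , s , K.trans (K.*-congˡ (K.sym x≈y)) dx≈w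

  fraction-∈ : ∀ {w} → ℤ[ z ] w → Fraction (ι w)
  fraction-∈ {w} s = + 1 , (λ ()) , w , s , K.trans (K.*-congʳ K.⟨1⟩) (K.*-identityˡ (ι w))

  fraction : ∀ {x} → SubfieldGeneratedBy (fieldRing K) ζ x → Fraction x
  fraction gen          = fraction-resp ιz≈ζ (fraction-∈ gen)
  fraction one          = fraction-resp 1#-homo (fraction-∈ one)
  fraction (add g h)    = fraction-+ (fraction g) (fraction h)
  fraction (neg g)      = fraction-neg (fraction g)
  fraction (mul g h)    = fraction-* (fraction g) (fraction h)
  fraction (inv xy≈1 g) = fraction-⁻¹ xy≈1 (fraction g)
  fraction (resp x≈y g) = fraction-resp x≈y (fraction g)

  open CyclotomicIntegers O noZeroDivisors characteristicZero-O integral m p-prime z z-primitive public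

  O≡ℤ[z] : ∀ x → ℤ[ z ] x
  O≡ℤ[z] x = clear-denominator (fraction (generated (ι x)))
    where
    clear-denominator : Fraction (ι x) → ℤ[ z ] x
    clear-denominator (d , d≢0 , w , s , dx≈w) =
      saturated d≢0 (resp (sym (injective (K.trans (ι-⟨⟩* d x) dx≈w))) s)

-- Linear algebra over ℤ

module ℤSum = SemiringSum (CommutativeRing.semiring ℤ.+-*-commutativeRing)

-- The dimension is bounded by eliminating one column with a pivot row at a time.
independent-rows⇒≤ : ∀ {N n} (M : Fin N → Vector ℤ n) →
  (∀ (c : Vector ℤ N) → (∀ i → ℤSum.sum (λ j → c j ℤ.* M j i) ≡ + 0) → ∀ j → c j ≡ + 0) → N ℕ.≤ n
independent-rows⇒≤ {zero}          M indep = ℕ.z≤n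
independent-rows⇒≤ {suc N} {zero}  M indep = contradiction (indep (λ _ → + 1) (λ ()) Fin.zero) λ ()
independent-rows⇒≤ {suc N} {suc n} M indep with Fin.any? (λ r → ¬? (M r Fin.zero ℤ.≟ + 0))
... | no  no-pivot = ℕ.m≤n⇒m≤1+n (independent-rows⇒≤ (tail ∘ M) λ c cM≡0 → indep c λ where
      Fin.zero    → ≡.trans (ℤSum.sum-cong-≋ λ j → ≡.trans (≡.cong (c j ℤ.*_) (column≡0 j)) (ℤ.*-zeroʳ (c j)))
                      (ℤSum.sum-replicate-zero (suc N))
      (Fin.suc i) → cM≡0 i)
  where
  column≡0 : ∀ j → M j Fin.zero ≡ + 0
  column≡0 j = decidable-stable (M j Fin.zero ℤ.≟ + 0) (λ Mj≢0 → no-pivot (j , Mj≢0))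
... | yes (r , α≢0) = ℕ.s≤s (independent-rows⇒≤ M′ indep′)
  where
  open ≡.≡-Reasoning
  open ℤSolver.+-*-Solver

  α = M r Fin.zero
  row : Fin N → Vector ℤ (suc n)
  row j = M (punchIn r j)

  -- Elimination without division: each row is scaled by the pivot before the pivot row is
  -- subtracted.
  M′ : Fin N → Vector ℤ n
  M′ j i = α ℤ.* row j (Fin.suc i) ℤ.- row j Fin.zero ℤ.* M r (Fin.suc i)

  module _ (c : Vector ℤ N) (cM′≡0 : ∀ i → ℤSum.sum (λ j → c j ℤ.* M′ j i) ≡ + 0) where

    s : ℤ
    s = ℤSum.sum (λ j → c j ℤ.* row j Fin.zero)

    -- A relation among the reduced rows lifts to the original ones: scale by `α`, and give the
    -- pivot row the coefficient that cancels the first column.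
    c⁺ : Vector ℤ (suc N)
    c⁺ = Vector.insertAt (λ j → α ℤ.* c j) r (ℤ.- s)

    eliminate : ∀ i → ℤSum.sum (λ j → c⁺ j ℤ.* M j i) ≡
                ℤSum.sum (λ j → c j ℤ.* (α ℤ.* row j i ℤ.- row j Fin.zero ℤ.* M r i))
    eliminate i = begin
      ℤSum.sum (λ j → c⁺ j ℤ.* M j i)
        ≡⟨ ℤSum.sum-remove {i = r} (λ j → c⁺ j ℤ.* M j i) ⟩
      c⁺ r ℤ.* M r i ℤ.+ ℤSum.sum (λ j → c⁺ (punchIn r j) ℤ.* row j i)
        ≡⟨ ≡.cong₂ (λ u v → u ℤ.* M r i ℤ.+ v) (insertAt-lookup (λ j → α ℤ.* c j) r (ℤ.- s))
             (ℤSum.sum-cong-≋ (λ j → ≡.cong (ℤ._* row j i) (insertAt-punchIn (λ j → α ℤ.* c j) r (ℤ.- s) j))) ⟩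
      ℤ.- s ℤ.* M r i ℤ.+ ℤSum.sum (λ j → α ℤ.* c j ℤ.* row j i)
        ≡⟨ ≡.cong (ℤ._+ ℤSum.sum (λ j → α ℤ.* c j ℤ.* row j i)) (≡.trans (solve 2 (λ s m → (:- s) :* m := s :* (:- m)) ≡.refl s (M r i))
             (ℤSum.*-distribʳ-sum (ℤ.- M r i) (λ j → c j ℤ.* row j Fin.zero))) ⟩
      ℤSum.sum (λ j → c j ℤ.* row j Fin.zero ℤ.* ℤ.- M r i) ℤ.+ ℤSum.sum (λ j → α ℤ.* c j ℤ.* row j i)
        ≡⟨ ℤSum.∑-distrib-+ (λ j → c j ℤ.* row j Fin.zero ℤ.* ℤ.- M r i) (λ j → α ℤ.* c j ℤ.* row j i) ⟨
      ℤSum.sum (λ j → c j ℤ.* row j Fin.zero ℤ.* ℤ.- M r i ℤ.+ α ℤ.* c j ℤ.* row j i)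
        ≡⟨ ℤSum.sum-cong-≋ (λ j → solve 5 (λ c m k a e → c :* m :* (:- k) :+ a :* c :* e := c :* (a :* e :- m :* k))
             ≡.refl (c j) (row j Fin.zero) (M r i) α (row j i)) ⟩
      ℤSum.sum (λ j → c j ℤ.* (α ℤ.* row j i ℤ.- row j Fin.zero ℤ.* M r i)) ∎

    c⁺M≡0 : ∀ i → ℤSum.sum (λ j → c⁺ j ℤ.* M j i) ≡ + 0
    c⁺M≡0 Fin.zero    = ≡.trans (eliminate Fin.zero) (≡.trans
      (ℤSum.sum-cong-≋ (λ j → solve 3 (λ c a m → c :* (a :* m :- m :* a) := con (+ 0)) ≡.refl (c j) α (row j Fin.zero)))
      (ℤSum.sum-replicate-zero N))
    c⁺M≡0 (Fin.suc i) = ≡.trans (eliminate (Fin.suc i)) (cM′≡0 i)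

    indep′ : ∀ j → c j ≡ + 0
    indep′ j = [ (λ α≡0 → contradiction α≡0 α≢0) , id ]′ (ℤ.i*j≡0⇒i≡0∨j≡0 α
      (≡.trans (≡.sym (insertAt-punchIn (λ j → α ℤ.* c j) r (ℤ.- s) j)) (indep c⁺ c⁺M≡0 (punchIn r j))))

-- Twisted derivations

module TwistedDerivations {a ℓ} (R : CommutativeRing a ℓ)
  (noZeroDivisors : NoZeroDivisors R) (characteristicZero : CharacteristicZero R)
  (z : CommutativeRing.Carrier R) (R≡ℤ[z] : ∀ x → IntegerScalars.ℤ[_] R z x)
  {σ τ : CommutativeRing.Carrier R → CommutativeRing.Carrier R}
  (σ-endo : IsRingEndomorphism R σ) (τ-endo : IsRingEndomorphism R τ)
  (σ-nonzero : IsNonZeroMap R σ) (τ-nonzero : IsNonZeroMap R τ)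
  (σ≉τ : AreDifferentMaps R σ τ)
  where

  open CommutativeRing R
  open CommutativeSemiringExp commutativeSemiring using (_^_)
  open IntegerScalars R
  open IntegralDomain R noZeroDivisors characteristicZero
  open IntegerMultiples +-abelianGroup using (_·_)
  open SemiringSum semiring
  open Solver using (solve; _:=_; _:+_; _:*_; _:-_; :-_; con)
  open SetoidReasoning setoid
  open LeftModule (𝓓 R σ τ) using (_≈ᴹ_)

  module NonZeroEndomorphism {φ : Carrier → Carrier} (φ-endo : IsRingEndomorphism R φ) (φ-nonzero : IsNonZeroMap R φ) where
    open IsRingWithoutOneHomomorphism φ-endo public

    φ[1]≉0 : ¬ (φ 1# ≈ 0#)
    φ[1]≉0 φ[1]≈0 = φ-nonzero λ x → begin
      φ x           ≈⟨ ⟦⟧-cong (*-identityˡ x) ⟨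
      φ (1# * x)    ≈⟨ *-homo 1# x ⟩
      φ 1# * φ x    ≈⟨ *-congʳ φ[1]≈0 ⟩
      0# * φ x      ≈⟨ zeroˡ (φ x) ⟩
      0#            ∎

    -- Endomorphisms are not assumed unital, but `φ 1#` is a non-zero idempotent and can be
    -- cancelled.
    1#-homo : φ 1# ≈ 1#
    1#-homo = *-cancelˡ φ[1]≉0 (begin
      φ 1# * φ 1#   ≈⟨ *-homo 1# 1# ⟨
      φ (1# * 1#)   ≈⟨ ⟦⟧-cong (*-identityʳ 1#) ⟩
      φ 1#          ≈⟨ *-identityʳ (φ 1#) ⟨
      φ 1# * 1#     ∎)

    ⟨+⟩-homo : ∀ n → φ ⟨ + n ⟩ ≈ ⟨ + n ⟩
    ⟨+⟩-homo zero    = 0#-homo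
    ⟨+⟩-homo (suc n) = trans (+-homo 1# ⟨ + n ⟩) (+-cong 1#-homo (⟨+⟩-homo n))

    ⟨⟩-homo : ∀ i → φ ⟨ i ⟩ ≈ ⟨ i ⟩
    ⟨⟩-homo (+ n)    = ⟨+⟩-homo n
    ⟨⟩-homo -[1+ n ] = trans (⁻¹-homo ⟨ + suc n ⟩) (-‿cong (⟨+⟩-homo (suc n)))

    ·-homo : ∀ i x → φ (i · x) ≈ ⟨ i ⟩ * φ x
    ·-homo i x = trans (⟦⟧-cong (·≈⟨⟩* i x)) (trans (*-homo ⟨ i ⟩ x) (*-congʳ (⟨⟩-homo i)))

  private
    module σ = NonZeroEndomorphism σ-endo σ-nonzero
    module τ = NonZeroEndomorphism τ-endo τ-nonzero

  -- The inner twisted derivation attached to `1`; dividing it by `Δ z` yields the generator `δ`.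
  Δ : Carrier → Carrier
  Δ x = τ x - σ x

  Δ-* : ∀ x y → Δ (x * y) ≈ Δ x * τ y + σ x * Δ y
  Δ-* x y = trans (+-cong (τ.*-homo x y) (-‿cong (σ.*-homo x y)))
    (solve 4 (λ tx ty sx sy → tx :* ty :- sx :* sy := (tx :- sx) :* ty :+ sx :* (ty :- sy)) refl (τ x) (τ y) (σ x) (σ y))

  Δ-+ : ∀ x y → Δ (x + y) ≈ Δ x + Δ y
  Δ-+ x y = trans (+-cong (τ.+-homo x y) (-‿cong (σ.+-homo x y)))
    (solve 4 (λ tx ty sx sy → tx :+ ty :- (sx :+ sy) := (tx :- sx) :+ (ty :- sy)) refl (τ x) (τ y) (σ x) (σ y))

  Δ-neg : ∀ x → Δ (- x) ≈ - Δ x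
  Δ-neg x = trans (+-cong (τ.⁻¹-homo x) (-‿cong (σ.⁻¹-homo x)))
    (solve 2 (λ t s → (:- t) :- (:- s) := :- (t :- s)) refl (τ x) (σ x))

  Δ-cong : ∀ {x y} → x ≈ y → Δ x ≈ Δ y
  Δ-cong x≈y = +-cong (τ.⟦⟧-cong x≈y) (-‿cong (σ.⟦⟧-cong x≈y))

  -- The twisted Leibniz rule carries divisibility from factors to products, so it spreads from `z`
  -- to everything that `z` generates.
  Δ[z]∣Δ : ∀ {x} → ℤ[ z ] x → ∃[ y ] Δ z * y ≈ Δ x
  Δ[z]∣Δ gen = 1# , *-identityʳ (Δ z)
  Δ[z]∣Δ one = 0# , trans (zeroʳ (Δ z)) (sym (trans (+-cong τ.1#-homo (-‿cong σ.1#-homo)) (-‿inverseʳ 1#)))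
  Δ[z]∣Δ (add {x} {y} s t) with Δ[z]∣Δ s | Δ[z]∣Δ t
  ... | u , eq | v , eq′ = u + v , trans (distribˡ (Δ z) u v) (trans (+-cong eq eq′) (sym (Δ-+ x y)))
  Δ[z]∣Δ (neg {x} s) with Δ[z]∣Δ s
  ... | u , eq = - u , trans (solve 2 (λ d u → d :* (:- u) := :- (d :* u)) refl (Δ z) u) (trans (-‿cong eq) (sym (Δ-neg x)))
  Δ[z]∣Δ (mul {x} {y} s t) with Δ[z]∣Δ s | Δ[z]∣Δ t
  ... | u , eq | v , eq′ = u * τ y + σ x * v , trans
    (solve 5 (λ d u t s v → d :* (u :* t :+ s :* v) := d :* u :* t :+ s :* (d :* v)) refl (Δ z) u (τ y) (σ x) v)
    (trans (+-cong (*-congʳ eq) (*-congˡ eq′)) (sym (Δ-* x y)))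
  Δ[z]∣Δ (resp x≈y s) with Δ[z]∣Δ s
  ... | u , eq = u , trans eq (Δ-cong x≈y)

  -- The value is computed from a membership proof, so even compatibility with `≈` is not automatic;
  -- `δ-unique` recovers this and all algebraic laws by cancelling `Δ z`.
  δ : Carrier → Carrier
  δ x = proj₁ (Δ[z]∣Δ (R≡ℤ[z] x))

  Δ[z]*δ : ∀ x → Δ z * δ x ≈ Δ x
  Δ[z]*δ x = proj₂ (Δ[z]∣Δ (R≡ℤ[z] x))

  -- Maps that agree at the generator would agree everywhere. This is where `σ` and `τ` being
  -- different enters.
  Δ[z]≉0 : ¬ (Δ z ≈ 0#)
  Δ[z]≉0 Δ[z]≈0 = σ≉τ λ x → begin
    σ x                          ≈⟨ solve 2 (λ s t → s := t :- (t :- s)) refl (σ x) (τ x) ⟩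
    τ x - Δ x                    ≈⟨ +-congˡ (-‿cong (trans (sym (Δ[z]*δ x)) (trans (*-congʳ Δ[z]≈0) (zeroˡ (δ x))))) ⟩
    τ x - 0#                     ≈⟨ solve 1 (λ t → t :- con (+ 0) := t) refl (τ x) ⟩
    τ x                          ∎

  δ-unique : ∀ {x y} → Δ z * y ≈ Δ x → δ x ≈ y
  δ-unique {x} eq = *-cancelˡ Δ[z]≉0 (trans (Δ[z]*δ x) (sym eq))

  δ-cong : ∀ {x y} → x ≈ y → δ x ≈ δ y
  δ-cong {x} {y} x≈y = δ-unique (trans (Δ[z]*δ y) (Δ-cong (sym x≈y)))

  δ-+ : ∀ x y → δ (x + y) ≈ δ x + δ y
  δ-+ x y = δ-unique (trans (distribˡ (Δ z) (δ x) (δ y)) (trans (+-cong (Δ[z]*δ x) (Δ[z]*δ y)) (sym (Δ-+ x y))))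

  δ-0 : δ 0# ≈ 0#
  δ-0 = δ-unique (trans (zeroʳ (Δ z)) (sym (trans (+-cong τ.0#-homo (-‿cong σ.0#-homo)) (-‿inverseʳ 0#))))

  δ-neg : ∀ x → δ (- x) ≈ - δ x
  δ-neg x = δ-unique (trans (solve 2 (λ d u → d :* (:- u) := :- (d :* u)) refl (Δ z) (δ x))
    (trans (-‿cong (Δ[z]*δ x)) (sym (Δ-neg x))))

  δ-· : ∀ i x → δ (i · x) ≈ ⟨ i ⟩ * δ x
  δ-· i x = δ-unique (begin
    Δ z * (⟨ i ⟩ * δ x)         ≈⟨ solve 3 (λ d i u → d :* (i :* u) := i :* (d :* u)) refl (Δ z) ⟨ i ⟩ (δ x) ⟩
    ⟨ i ⟩ * (Δ z * δ x)         ≈⟨ *-congˡ (Δ[z]*δ x) ⟩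
    ⟨ i ⟩ * (τ x - σ x)         ≈⟨ solve 3 (λ i t s → i :* (t :- s) := i :* t :- i :* s) refl ⟨ i ⟩ (τ x) (σ x) ⟩
    ⟨ i ⟩ * τ x - ⟨ i ⟩ * σ x   ≈⟨ +-cong (τ.·-homo i x) (-‿cong (σ.·-homo i x)) ⟨
    Δ (i · x)                   ∎)

  δ-* : ∀ x y → δ (x * y) ≈ δ x * τ y + σ x * δ y
  δ-* x y = δ-unique (begin
    Δ z * (δ x * τ y + σ x * δ y)
      ≈⟨ solve 5 (λ d u t s v → d :* (u :* t :+ s :* v) := d :* u :* t :+ s :* (d :* v)) refl (Δ z) (δ x) (τ y) (σ x) (δ y) ⟩
    Δ z * δ x * τ y + σ x * (Δ z * δ y)
      ≈⟨ +-cong (*-congʳ (Δ[z]*δ x)) (*-congˡ (Δ[z]*δ y)) ⟩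
    Δ x * τ y + σ x * Δ y
      ≈⟨ Δ-* x y ⟨
    Δ (x * y) ∎)

  δ[z]≈1 : δ z ≈ 1#
  δ[z]≈1 = δ-unique (*-identityʳ (Δ z))

  multipleOfδ : Carrier → Derivation R σ τ
  multipleOfδ u = (λ x → u * δ x) , record
    { ℤ-linear = record
      { +ᴹ-isGroupHomomorphism = record
        { isMonoidHomomorphism = record
          { isMagmaHomomorphism = record
            { isRelHomomorphism = record { cong = λ x≈y → *-congˡ (δ-cong x≈y) }
            ; homo = λ x y → trans (*-congˡ (δ-+ x y)) (distribˡ u (δ x) (δ y))
            }
          ; ε-homo = trans (*-congˡ δ-0) (zeroʳ u)
          }
        ; ⁻¹-homo = λ x → trans (*-congˡ (δ-neg x)) (solve 2 (λ u v → u :* (:- v) := :- (u :* v)) refl u (δ x))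
        }
      ; *ₗ-homo = λ i x → trans (*-congˡ (δ-· i x))
          (trans (solve 3 (λ u i v → u :* (i :* v) := i :* (u :* v)) refl u ⟨ i ⟩ (δ x)) (sym (·≈⟨⟩* i (u * δ x))))
      }
    ; leibniz = λ x y → trans (*-congˡ (δ-* x y))
        (solve 5 (λ u a t s b → u :* (a :* t :+ s :* b) := u :* a :* t :+ s :* (u :* b)) refl u (δ x) (τ y) (σ x) (δ y))
    }

  -- Compare the two Leibniz expansions of D (x z) = D (z x).
  derivation≈ : (D : Derivation R σ τ) → ∀ x → proj₁ D x ≈ proj₁ D z * δ x
  derivation≈ (D , isDerivation) x = *-cancelˡ Δ[z]≉0 (begin
    (τ z - σ z) * D x
      ≈⟨ solve 5 (λ t s d S e → (t :- s) :* d := (d :* t :+ S :* e) :- (S :* e :+ s :* d)) refl (τ z) (σ z) (D x) (σ x) (D z) ⟩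
    (D x * τ z + σ x * D z) - (σ x * D z + σ z * D x)
      ≈⟨ +-congʳ (trans (sym (leibniz x z)) (trans (⟦⟧-cong (*-comm x z)) (leibniz z x))) ⟩
    (D z * τ x + σ z * D x) - (σ x * D z + σ z * D x)
      ≈⟨ solve 4 (λ e T f S → (e :* T :+ f) :- (S :* e :+ f) := e :* (T :- S)) refl (D z) (τ x) (σ z * D x) (σ x) ⟩
    D z * Δ x
      ≈⟨ *-congˡ (Δ[z]*δ x) ⟨
    D z * (Δ z * δ x)
      ≈⟨ solve 3 (λ e d u → e :* (d :* u) := d :* (e :* u)) refl (D z) (Δ z) (δ x) ⟩
    Δ z * (D z * δ x) ∎)
    where
    open IsDerivation isDerivation
    open IsLeftModuleHomomorphism ℤ-linear using (⟦⟧-cong)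

  -- Evaluation at `z` identifies derivations with ring elements; here it moves linear combinations
  -- into the ring.
  linearCombination-apply : ∀ {n} (c : Vector ℤ n) (v : Vector (Derivation R σ τ) n) x →
    proj₁ (linearCombination (𝓓 R σ τ) c v) x ≈ sum (λ i → ⟨ c i ⟩ * proj₁ (v i) z) * δ x
  linearCombination-apply {zero}  c v x = sym (zeroˡ (δ x))
  linearCombination-apply {suc n} c v x = trans
    (+-cong (trans (·≈⟨⟩* (c Fin.zero) _) (trans (*-congˡ (derivation≈ (v Fin.zero) x)) (sym (*-assoc _ _ (δ x)))))
      (linearCombination-apply (tail c) (tail v) x))
    (sym (distribʳ (δ x) _ _))

  -- Transport of the basis of the ring to the derivations, and the rank

  module _ {n} (ϖ : Carrier) (spanned : ∀ x → Σ[ c ∈ Vector ℤ n ] x ≈ poly c ϖ)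
           (independent : (c : Vector ℤ n) → poly c ϖ ≈ 0# → ∀ i → c i ≡ + 0) where

    basis : Vector (Derivation R σ τ) n
    basis i = multipleOfδ (ϖ ^ toℕ i)

    basis-apply : ∀ c x → proj₁ (linearCombination (𝓓 R σ τ) c basis) x ≈ poly c ϖ * δ x
    basis-apply c x = trans (linearCombination-apply c basis x)
      (*-congʳ (sum-cong-≋ {n} (λ i → *-congˡ (trans (*-congˡ δ[z]≈1) (*-identityʳ _)))))

    basis-spans : (D : Derivation R σ τ) → Σ[ c ∈ Vector ℤ n ] (D ≈ᴹ linearCombination (𝓓 R σ τ) c basis)
    basis-spans D = c , λ x → trans (derivation≈ D x) (trans (*-congʳ D[z]≈c) (sym (basis-apply c x)))
      where
      c = proj₁ (spanned (proj₁ D z))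
      D[z]≈c = proj₂ (spanned (proj₁ D z))

    -- Since `δ z` is `1#`, evaluating a relation at `z` returns a relation among the powers of `ϖ`.
    basis-independent : LinearlyIndependent (𝓓 R σ τ) basis
    basis-independent c cb≈0 = independent c (begin
      poly c ϖ          ≈⟨ *-identityʳ (poly c ϖ) ⟨
      poly c ϖ * 1#     ≈⟨ *-congˡ δ[z]≈1 ⟨
      poly c ϖ * δ z    ≈⟨ basis-apply c z ⟨
      _                 ≈⟨ cb≈0 z ⟩
      0#                ∎)

    sum-poly : ∀ {N} (c : Vector ℤ N) (M : Fin N → Vector ℤ n) →
               sum (λ j → ⟨ c j ⟩ * poly (M j) ϖ) ≈ poly (λ i → ℤSum.sum (λ j → c j ℤ.* M j i)) ϖ
    sum-poly {zero}  c M = sym (poly-0 n ϖ)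
    sum-poly {suc N} c M = trans
      (+-cong (sym (poly-scale (c Fin.zero) (M Fin.zero) ϖ)) (sum-poly (tail c) (tail M)))
      (sym (poly-+ (λ i → c Fin.zero ℤ.* M Fin.zero i) (λ i → ℤSum.sum (λ j → tail c j ℤ.* tail M j i)) ϖ))

    -- The coordinates of the values at `z` form an integer matrix with `n` columns, and a relation
    -- among its rows is one among the derivations.
    independent⇒≤ : ∀ N (v : Vector (Derivation R σ τ) N) → LinearlyIndependent (𝓓 R σ τ) v → N ℕ.≤ n
    independent⇒≤ N v v-independent = independent-rows⇒≤ M λ c cM≡0 → v-independent c λ x → begin
      proj₁ (linearCombination (𝓓 R σ τ) c v) x
        ≈⟨ linearCombination-apply c v x ⟩
      sum (λ j → ⟨ c j ⟩ * proj₁ (v j) z) * δ x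
        ≈⟨ *-congʳ (sum-cong-≋ {N} (λ j → *-congˡ (proj₂ (spanned (proj₁ (v j) z))))) ⟩
      sum (λ j → ⟨ c j ⟩ * poly (M j) ϖ) * δ x
        ≈⟨ *-congʳ (trans (sum-poly c M) (trans (poly-cong ϖ cM≡0) (poly-0 n ϖ))) ⟩
      0# * δ x
        ≈⟨ zeroˡ (δ x) ⟩
      0# ∎
      where
      M : Fin N → Vector ℤ n
      M j = proj₁ (spanned (proj₁ (v j) z))

    finitelyGenerated : FinitelyGenerated (𝓓 R σ τ)
    finitelyGenerated = n , basis , basis-spans

    hasRank : HasRank (𝓓 R σ τ) n
    hasRank = (basis , basis-independent) , independent⇒≤

corollary3p9 : ∀ {c ℓ₁ ℓ₂ a ℓ : Level} (p : ℕ) → Prime p → ¬ (2 ∣ p) →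
    (K : HeytingField c ℓ₁ ℓ₂) (ζ : HeytingField.Carrier K) → IsCyclotomicField K p ζ →
    (O : CommutativeRing a ℓ) (ι : CommutativeRing.Carrier O → HeytingField.Carrier K) →
    IsRingOfIntegers O K ι →
    (σ τ : CommutativeRing.Carrier O → CommutativeRing.Carrier O) →
    IsRingEndomorphism O σ → IsRingEndomorphism O τ →
    IsNonZeroMap O σ → IsNonZeroMap O τ → AreDifferentMaps O σ τ →
    FinitelyGenerated (𝓓 O σ τ) × HasRank (𝓓 O σ τ) (p ∸ 1)
corollary3p9 zero          p-prime = contradiction p-prime ¬prime[0]
corollary3p9 (suc zero)    p-prime = contradiction p-prime ¬prime[1]
corollary3p9 (suc (suc m)) p-prime _ K ζ cyclotomic O ι integers σ τ σ-endo τ-endo σ≉0 τ≉0 σ≉τ =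
  finitelyGenerated ϖ spanned powers-independent , hasRank ϖ spanned powers-independent
  where
  open CyclotomicField K ζ m p-prime cyclotomic O ι integers
  open TwistedDerivations O noZeroDivisors characteristicZero-O z O≡ℤ[z] σ-endo τ-endo σ≉0 τ≉0 σ≉τ

  spanned : ∀ x → Spanned x
  spanned x = ℤ[z]-spanned (O≡ℤ[z] x)
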